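{- Let $\sigma\in\{st,co,gr,pr,se,id,ea,na,stg\}$, let $\mathsf{rIAF}=(A^F,R^F,A^?,R^?,R^{\leftrightarrow})$ be a rich incomplete argumentation framework, and let $a\in A^F$. Then: (1) the answer to $\sigma$-NSA with input $\mathsf{rIAF}$ and $a$ is yes iff $v_{\mathsf{rIAF}}\models[\mathsf{makeComp}^{\mathsf{rIAF}};\mathsf{makeExt}^\sigma]\mathtt{in}_a$; (2) the answer to $\sigma$-NCA with input $\mathsf{rIAF}$ and $a$ is yes iff $v_{\mathsf{rIAF}}\models[\mathsf{makeComp}^{\mathsf{rIAF}}]\langle\mathsf{makeExt}^\sigma\rangle\mathtt{in}_a$; (3) the answer to $\sigma$-PCA with input $\mathsf{rIAF}$ and $a$ is yes iff $v_{\mathsf{rIAF}}\models\langle\mathsf{makeComp}^{\mathsf{rIAF}};\mathsf{makeExt}^\sigma\rangle\mathtt{in}_a$; (4) the answer to $\sigma$-PSA with input $\mathsf{rIAF}$ and $a$ is yes iff $v_{\mathsf{rIAF}}\models\langle\mathsf{makeComp}^{\mathsf{rIAF}}\rangle[\mathsf{makeExt}^\sigma]\mathtt{in}_a$.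
   Context: **Argumentation.** Fix a finite non-empty set $\mathcal U$ of arguments. For $A\subseteq\mathcal U$, $R\subseteq\mathcal U\times\mathcal U$, let $R\upharpoonright_A=R\cap(A\times A)$. An argumentation framework (AF) is a pair $(A,R)$ with $A\subseteq\mathcal U$, $R\subseteq A\times A$. For $E\subseteq A$: $E^+=\{x\in A\mid\exists y\in E:(y,x)\in R\}$, $E^\oplus=E\cup E^+$ (range). $E$ is conflict-free iff $E\cap E^+=\emptyset$; $E$ defends $a\in A$ iff every $x\in A$ with $(x,a)\in R$ is in $E^+$; $E$ is admissible iff it is conflict-free and defends all its members. $\sigma(A,R)$ denotes the set of $\sigma$-extensions of $(A,R)$, where $E\subseteq A$ is: stable ($st$) iff conflict-free and $A\setminus E\subseteq E^+$; complete ($co$) iff conflict-free and $E$ contains precisely the arguments of $A$ it defends; grounded ($gr$) iff a $\subseteq$-minimal complete extension; preferred ($pr$) iff a $\subseteq$-maximal complete extension; semi-stable ($se$) iff complete and there is no complete $E'$ with $E^\oplus\subset E'^\oplus$ (strict); ideal ($id$) iff the $\subseteq$-maximal ideal set, an ideal set being an admissible set contained in every preferred extension; eager ($ea$) iff the $\subseteq$-maximal eager set, an eager set being an admissible set contained in every semi-stable extension; naive ($na$) iff a $\subseteq$-maximal conflict-free set; stage ($stg$) iff conflict-free with $\subseteq$-maximal range among conflict-free sets. **Rich incomplete AFs.** A rich incomplete AF (rIAF) is $(A^F,R^F,A^?,R^?,R^{\leftrightarrow})$ with $A^F,A^?\subseteq\mathcal U$ disjoint, $R^F,R^?,R^{\leftrightarrow}\subseteq(A^F\cup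 A^?)\times(A^F\cup A^?)$ pairwise disjoint, and $R^{\leftrightarrow}$ symmetric and irreflexive. A completion is any AF $(A^*,R^*)$ with $A^F\subseteq A^*\subseteq A^F\cup A^?$; $R^F\upharpoonright_{A^*}\subseteq R^*\subseteq(R^F\cup R^?\cup R^{\leftrightarrow})\upharpoonright_{A^*}$; and for all $x,y\in A^*$, $(x,y)\in R^{\leftrightarrow}$ implies $(x,y)\in R^*$ or $(y,x)\in R^*$. Decision problems for input an rIAF and $a\in A^F$: $\sigma$-NSA (necessary sceptical acceptance): for every completion $(A^*,R^*)$ and every $E\in\sigma(A^*,R^*)$, $a\in E$? $\sigma$-NCA (necessary credulous): for every completion there is $E\in\sigma(A^*,R^*)$ with $a\in E$? $\sigma$-PCA (possible credulous): is there a completion and an $E\in\sigma(A^*,R^*)$ with $a\in E$? $\sigma$-PSA (possible sceptical): is there a completion such that $a\in E$ for every $E\in\sigma(A^*,R^*)$? **DL-PA.** $\mathtt{Prp}$ is a countably infinite set of propositional variables containing the pairwise distinct variables $\mathtt{aw}_x$, $\mathtt{in}_x$ ($x\in\mathcal U$), $\mathtt r_{x,y}$ ($x,y\in\mathcal U$), and further fresh variables $\mathtt{in}'_x$ ($x\in\mathcal U$). Let $\mathsf{IN}_{\mathcal U}=\{\mathtt{in}_x\mid x\in\mathcal U\}$, $\mathsf{AW}_A=\{\mathtt{aw}_x\mid x\in A\}$, $\mathsf{ATT}_R=\{\mathtt r_{x,y}\mid(x,y)\in R\}$. Formulas and programs: $\varphi::=p\mid\neg\varphi\mid(\varphi\wedge\varphi)\mid[\pi]\varphi$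 and $\pi::=+p\mid -p\mid\varphi?\mid(\pi;\pi)\mid(\pi\cup\pi)\mid\pi^{ -1}$, $p\in\mathtt{Prp}$. Valuations are subsets $v\subseteq\mathtt{Prp}$; $v\models p$ iff $p\in v$; Booleans as usual; $v\models[\pi]\varphi$ iff $v'\models\varphi$ for all $v'$ with $(v,v')\in||\pi||$; $\langle\pi\rangle\varphi=\neg[\pi]\neg\varphi$. Programs are interpreted by $||+p||=\{(v,v\cup\{p\})\}$, $||-p||=\{(v,v\setminus\{p\})\}$, $||\varphi?||=\{(v,v)\mid v\models\varphi\}$, $;$ is relation composition, $\cup$ is union, $\pi^{ -1}$ is the inverse relation. $\mathsf{skip}=\top?$. For finite $P=\{p_1,\dots,p_n\}\subseteq\mathtt{Prp}$: $\mathsf{mkTrueOne}(P)=\bigcup_{p\in P}(\neg p?;+p)$, $\mathsf{mkFalseOne}(P)=\bigcup_{p\in P}(p?;-p)$, $\mathsf{mkTrueSome}(P)=(+p_1\cup\mathsf{skip});\dots;(+p_n\cup\mathsf{skip})$, $\mathsf{mkFalseSome}(P)=(-p_1\cup\mathsf{skip});\dots;(-p_n\cup\mathsf{skip})$, $\mathsf{vary}(P)=(+p_1\cup -p_1);\dots;(+p_n\cup -p_n)$ (empty sequences and unions are $\mathsf{skip}$). **Extension programs.** For each $\sigma$, $\mathsf{makeExt}^\sigma=\mathsf{vary}(\mathsf{IN}_{\mathcal U});\varphi_\sigma?$, where $\varphi_{st}=\mathsf{Stable}$, $\varphi_{co}=\mathsf{Complete}$, $\varphi_{gr}=\mathsf{Grounded}$,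 $\varphi_{pr}=\mathsf{Preferred}$, $\varphi_{na}=\mathsf{Naive}$, $\varphi_{se}=\mathsf{SemiStable}$, $\varphi_{stg}=\mathsf{Stage}$, $\varphi_{id}=\mathsf{Ideal}$, $\varphi_{ea}=\mathsf{Eager}$ are the following (all indices range over $\mathcal U$): $\mathsf{Well}=\bigwedge_x(\mathtt{in}_x\to\mathtt{aw}_x)$; $\mathsf{ConFree}=\mathsf{Well}\wedge\bigwedge_x\bigwedge_y\neg(\mathtt{in}_x\wedge\mathtt{in}_y\wedge\mathtt r_{x,y})$; $\mathsf{Admissible}=\mathsf{ConFree}\wedge\bigwedge_x(\mathtt{in}_x\to\bigwedge_y((\mathtt{aw}_y\wedge\mathtt r_{y,x})\to\bigvee_z(\mathtt{in}_z\wedge\mathtt r_{z,y})))$; $\mathsf{copy}(\mathsf{IN}_{\mathcal U})$ = sequential composition over $x\in\mathcal U$ of $(\mathtt{in}_x?;+\mathtt{in}'_x)\cup(\neg\mathtt{in}_x?;-\mathtt{in}'_x)$; $\mathsf{Rg}_x=\mathtt{in}_x\vee(\mathtt{aw}_x\wedge\bigvee_y(\mathtt{in}_y\wedge\mathtt r_{y,x}))$, $\mathsf{Rg}'_x=\mathtt{in}'_x\vee(\mathtt{aw}_x\wedge\bigvee_y(\mathtt{in}'_y\wedge\mathtt r_{y,x}))$, $\mathsf{IncludedInCp}=\bigwedge_x(\mathsf{Rg}_x\to\mathsf{Rg}'_x)$, $\mathsf{IncludesCp}=\bigwedge_x(\mathsf{Rg}'_x\to\mathsf{Rg}_x)$;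 $\mathsf{Stable}=\mathsf{Well}\wedge\bigwedge_x(\mathtt{aw}_x\to(\mathtt{in}_x\leftrightarrow\neg\bigvee_y(\mathtt{in}_y\wedge\mathtt r_{y,x})))$; $\mathsf{Complete}=\mathsf{ConFree}\wedge\bigwedge_x(\mathtt{in}_x\leftrightarrow\bigwedge_y((\mathtt{aw}_y\wedge\mathtt r_{y,x})\to\bigvee_z(\mathtt{in}_z\wedge\mathtt r_{z,y})))$; $\mathsf{Grounded}=\mathsf{Complete}\wedge[\mathsf{mkFalseOne}(\mathsf{IN}_{\mathcal U});\mathsf{mkFalseSome}(\mathsf{IN}_{\mathcal U})]\neg\mathsf{Complete}$; $\mathsf{Preferred}=\mathsf{Admissible}\wedge[\mathsf{mkTrueOne}(\mathsf{IN}_{\mathcal U});\mathsf{mkTrueSome}(\mathsf{IN}_{\mathcal U})]\neg\mathsf{Admissible}$; $\mathsf{Naive}=\mathsf{ConFree}\wedge[\mathsf{mkTrueOne}(\mathsf{IN}_{\mathcal U})]\neg\mathsf{ConFree}$; $\mathsf{SemiStable}=\mathsf{Complete}\wedge[\mathsf{copy}(\mathsf{IN}_{\mathcal U});\mathsf{makeExt}^{co}](\mathsf{IncludesCp}\to\mathsf{IncludedInCp})$; $\mathsf{Stage}=\mathsf{ConFree}\wedge[\mathsf{copy}(\mathsf{IN}_{\mathcal U});\mathsf{vary}(\mathsf{IN}_{\mathcal U});\mathsf{ConFree}?](\mathsf{IncludesCp}\to\mathsf{IncludedInCp})$; $\mathsf{IdealSet}=\mathsf{Admissible}\wedge\bigwedge_x(\mathtt{in}_x\to[\mathsf{makeExt}^{pr}]\mathtt{in}_x)$,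 $\mathsf{EagerSet}=\mathsf{Admissible}\wedge\bigwedge_x(\mathtt{in}_x\to[\mathsf{makeExt}^{se}]\mathtt{in}_x)$; $\mathsf{Ideal}=\mathsf{IdealSet}\wedge[\mathsf{mkTrueOne}(\mathsf{IN}_{\mathcal U});\mathsf{mkTrueSome}(\mathsf{IN}_{\mathcal U})]\neg\mathsf{IdealSet}$; $\mathsf{Eager}=\mathsf{EagerSet}\wedge[\mathsf{mkTrueOne}(\mathsf{IN}_{\mathcal U});\mathsf{mkTrueSome}(\mathsf{IN}_{\mathcal U})]\neg\mathsf{EagerSet}$. **Encoding of rIAFs.** For $R=\{(x_1,y_1),\dots,(x_n,y_n)\}$ let $\mathsf{dis}(\mathsf{ATT}_R)=(+\mathtt r_{x_1,y_1}\cup+\mathtt r_{y_1,x_1});\dots;(+\mathtt r_{x_n,y_n}\cup+\mathtt r_{y_n,x_n})$. Then $v_{\mathsf{rIAF}}=\mathsf{AW}_{A^F}\cup\mathsf{ATT}_{R^F}$ and $\mathsf{makeComp}^{\mathsf{rIAF}}=\mathsf{mkTrueSome}(\mathsf{AW}_{A^?});\mathsf{mkTrueSome}(\mathsf{ATT}_{R^?});\mathsf{dis}(\mathsf{ATT}_{R^{\leftrightarrow}})$.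
   Formalization: In the formula Complete (used for co, gr, se, ea) the equivalence for in_x is required only of x with aw_x true; as printed, over all x in U, Complete is unsatisfiable whenever an absent argument has no available attacker, e.g. U={0,1}, A^F={0}, all else empty, and the claim fails. -}

module Defs where

open import Data.Bool.Base using (Bool; true; false; if_then_else_; T)
open import Data.Fin.Base using (Fin)
open import Data.Fin.Properties using () renaming (_≟_ to _≟ᶠ_)
open import Data.Fin.Subset using (Subset; _∈_; _∉_; _⊆_; _⊂_; _∪_)
open import Data.Fin.Subset.Properties using (_∈?_)
open import Data.List.Base using (List; []; _∷_; _++_; map; foldr; filter; allFin; cartesianProduct)
open import Data.List.Membership.DecPropositional using () renaming (_∈?_ to member?)
open import Data.Nat.Base using (ℕ)
open import Data.Nat.Properties using () renaming (_≟_ to _≟ⁿ_)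
open import Data.Product using (_×_; _,_; ∃-syntax; proj₁; proj₂)
open import Data.Sum.Base using (_⊎_)
open import Level using (0ℓ)
open import Relation.Binary.Core using (Rel) renaming (_⇒_ to _⊆ᴿ_)
open import Relation.Binary.Definitions using (Symmetric; Irreflexive; DecidableEquality)
open import Relation.Binary.Construct.Union using () renaming (_∪_ to _∪ᴿ_)
open import Relation.Binary.PropositionalEquality using (_≡_; _≗_; refl; cong)
open import Relation.Nullary using (¬_; no; does)
open import Relation.Nullary.Decidable using (map′; _×-dec_)
open import Relation.Unary using (Pred) renaming (_⊂_ to _⊂ᴾ_)
open import Function.Bundles using (_⇔_)

-- Throughout, the finite universe of arguments is Fin n.

variable
  n : ℕ

------------------------------------------------------------------------
-- Argumentation frameworks

-- A subset of Fin n × Fin n, given by the set of successors of each element.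
Relation : ℕ → Set
Relation n = Fin n → Subset n

⌊_⌋ : Relation n → Rel (Fin n) 0ℓ
⌊ R ⌋ x y = y ∈ R x

infix 8 _↾_

_↾_ : Rel (Fin n) 0ℓ → Subset n → Rel (Fin n) 0ℓ
(R ↾ A) x y = R x y × x ∈ A × y ∈ A

_⊆_² : Relation n → Subset n → Set
R ⊆ A ² = ∀ x y → ⌊ R ⌋ x y → x ∈ A × y ∈ A

record AF (n : ℕ) : Set where
  field
    Arg   : Subset n
    Att   : Relation n
    Att⊆² : Att ⊆ Arg ²

  _⟶_ : Rel (Fin n) 0ℓ
  _⟶_ = ⌊ Att ⌋

module _ (F : AF n) where
  open AF F

  _⁺ : Subset n → Pred (Fin n) 0ℓ
  (E ⁺) x = x ∈ Arg × ∃[ y ] (y ∈ E × y ⟶ x)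

  _⊕ : Subset n → Pred (Fin n) 0ℓ
  (E ⊕) x = x ∈ E ⊎ (E ⁺) x

  Defends : Subset n → Fin n → Set
  Defends E a = ∀ x → x ∈ Arg → x ⟶ a → (E ⁺) x

  -- Every kind of extension below is conflict-free, so the requirement that
  -- E be a set of arguments of the framework is imposed here once and for all.
  ConflictFree : Subset n → Set
  ConflictFree E = E ⊆ Arg × (∀ x → x ∈ E → ¬ (E ⁺) x)

  AdmissibleSet : Subset n → Set
  AdmissibleSet E = ConflictFree E × (∀ a → a ∈ E → Defends E a)

  StableExt CompleteExt GroundedExt PreferredExt SemiStableExt : Subset n → Set
  StableExt E     = ConflictFree E × (∀ x → x ∈ Arg → x ∉ E → (E ⁺) x)
  CompleteExt E   = ConflictFree E × (∀ a → a ∈ Arg → (a ∈ E ⇔ Defends E a))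
  GroundedExt E   = CompleteExt E × (∀ E′ → CompleteExt E′ → ¬ (E′ ⊂ E))
  PreferredExt E  = CompleteExt E × (∀ E′ → CompleteExt E′ → ¬ (E ⊂ E′))
  SemiStableExt E = CompleteExt E × (∀ E′ → CompleteExt E′ → ¬ ((E ⊕) ⊂ᴾ (E′ ⊕)))

  IsIdealSet IsEagerSet : Subset n → Set
  IsIdealSet E = AdmissibleSet E × (∀ E′ → PreferredExt E′ → E ⊆ E′)
  IsEagerSet E = AdmissibleSet E × (∀ E′ → SemiStableExt E′ → E ⊆ E′)

  IdealExt EagerExt NaiveExt StageExt : Subset n → Set
  IdealExt E = IsIdealSet E × (∀ E′ → IsIdealSet E′ → ¬ (E ⊂ E′))
  EagerExt E = IsEagerSet E × (∀ E′ → IsEagerSet E′ → ¬ (E ⊂ E′))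
  NaiveExt E = ConflictFree E × (∀ E′ → ConflictFree E′ → ¬ (E ⊂ E′))
  StageExt E = ConflictFree E × (∀ E′ → ConflictFree E′ → ¬ ((E ⊕) ⊂ᴾ (E′ ⊕)))

data Semantics : Set where
  st co gr pr se id ea na stg : Semantics

Extension : Semantics → AF n → Subset n → Set
Extension st  = StableExt
Extension co  = CompleteExt
Extension gr  = GroundedExt
Extension pr  = PreferredExt
Extension se  = SemiStableExt
Extension id  = IdealExt
Extension ea  = EagerExt
Extension na  = NaiveExt
Extension stg = StageExt

------------------------------------------------------------------------
-- Rich incomplete argumentation frameworks

record RIAF (n : ℕ) : Set where
  field
    Aᶠ A? : Subset n
    Rᶠ R? R↔ : Relation n

    Aᶠ-A?-disjoint : ∀ x → x ∈ Aᶠ → x ∉ A?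

    Rᶠ⊆² : Rᶠ ⊆ (Aᶠ ∪ A?) ²
    R?⊆² : R? ⊆ (Aᶠ ∪ A?) ²
    R↔⊆² : R↔ ⊆ (Aᶠ ∪ A?) ²

    Rᶠ-R?-disjoint : ∀ x y → ⌊ Rᶠ ⌋ x y → ¬ ⌊ R? ⌋ x y
    Rᶠ-R↔-disjoint : ∀ x y → ⌊ Rᶠ ⌋ x y → ¬ ⌊ R↔ ⌋ x y
    R?-R↔-disjoint : ∀ x y → ⌊ R? ⌋ x y → ¬ ⌊ R↔ ⌋ x y

    R↔-symmetric   : Symmetric ⌊ R↔ ⌋
    R↔-irreflexive : Irreflexive _≡_ ⌊ R↔ ⌋

record IsCompletion (I : RIAF n) (F : AF n) : Set where
  open RIAF I
  open AF F
  field
    Aᶠ⊆Arg      : Aᶠ ⊆ Arg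
    Arg⊆Aᶠ∪A?   : Arg ⊆ (Aᶠ ∪ A?)
    Rᶠ⊆Att      : (⌊ Rᶠ ⌋ ↾ Arg) ⊆ᴿ _⟶_
    Att⊆R       : _⟶_ ⊆ᴿ ((⌊ Rᶠ ⌋ ∪ᴿ ⌊ R? ⌋ ∪ᴿ ⌊ R↔ ⌋) ↾ Arg)
    R↔-resolved : ∀ x y → x ∈ Arg → y ∈ Arg → ⌊ R↔ ⌋ x y → x ⟶ y ⊎ y ⟶ x

NSA NCA PCA PSA : Semantics → RIAF n → Fin n → Set
NSA σ I a = ∀ F → IsCompletion I F → ∀ E → Extension σ F E → a ∈ E
NCA σ I a = ∀ F → IsCompletion I F → ∃[ E ] (Extension σ F E × a ∈ E)
PCA σ I a = ∃[ F ] (IsCompletion I F × ∃[ E ] (Extension σ F E × a ∈ E))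
PSA σ I a = ∃[ F ] (IsCompletion I F × (∀ E → Extension σ F E → a ∈ E))

------------------------------------------------------------------------
-- DL-PA

-- The constructor `other makes the set of variables countably infinite.
data Prp (n : ℕ) : Set where
  `aw `in `in′ : Fin n → Prp n
  `r           : Fin n → Fin n → Prp n
  `other       : ℕ → Prp n

infix 4 _≟_

_≟_ : DecidableEquality (Prp n)
`aw x    ≟ `aw y    = map′ (cong `aw) (λ { refl → refl }) (x ≟ᶠ y)
`aw _    ≟ `in _    = no λ ()
`aw _    ≟ `in′ _   = no λ ()
`aw _    ≟ `r _ _   = no λ ()
`aw _    ≟ `other _ = no λ ()
`in _    ≟ `aw _    = no λ ()
`in x    ≟ `in y    = map′ (cong `in) (λ { refl → refl }) (x ≟ᶠ y)
`in _    ≟ `in′ _   = no λ ()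
`in _    ≟ `r _ _   = no λ ()
`in _    ≟ `other _ = no λ ()
`in′ _   ≟ `aw _    = no λ ()
`in′ _   ≟ `in _    = no λ ()
`in′ x   ≟ `in′ y   = map′ (cong `in′) (λ { refl → refl }) (x ≟ᶠ y)
`in′ _   ≟ `r _ _   = no λ ()
`in′ _   ≟ `other _ = no λ ()
`r _ _   ≟ `aw _    = no λ ()
`r _ _   ≟ `in _    = no λ ()
`r _ _   ≟ `in′ _   = no λ ()
`r x y   ≟ `r z w   =
  map′ (λ { (refl , refl) → refl }) (λ { refl → refl , refl }) ((x ≟ᶠ z) ×-dec (y ≟ᶠ w))
`r _ _   ≟ `other _ = no λ ()
`other _ ≟ `aw _    = no λ ()
`other _ ≟ `in _    = no λ ()
`other _ ≟ `in′ _   = no λ ()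
`other _ ≟ `r _ _   = no λ ()
`other i ≟ `other j = map′ (cong `other) (λ { refl → refl }) (i ≟ⁿ j)

infix  20 +_ -_
infixl 20 _⁻¹
infix  19 _¿
infixr 17 _⨾_
infixr 16 _⊔_
infix  15 ¬ᶠ_ [_]_ ⟨_⟩_
infixr 14 _∧ᶠ_
infixr 13 _∨ᶠ_
infixr 12 _→ᶠ_
infix  11 _↔ᶠ_

mutual
  data Formula (n : ℕ) : Set where
    var  : Prp n → Formula n
    ¬ᶠ_  : Formula n → Formula n
    _∧ᶠ_ : Formula n → Formula n → Formula n
    [_]_ : Program n → Formula n → Formula n

  data Program (n : ℕ) : Set where
    +_ -_ : Prp n → Program n
    _¿    : Formula n → Program n
    _⨾_   : Program n → Program n → Program n
    _⊔_   : Program n → Program n → Program n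
    _⁻¹   : Program n → Program n

-- Valuations are sets of variables, given by characteristic functions;
-- their equality is pointwise.
Valuation : ℕ → Set
Valuation n = Prp n → Bool

_[_≔_] : Valuation n → Prp n → Bool → Valuation n
(v [ p ≔ b ]) q = if does (q ≟ p) then b else v q

infix 4 _⊨_

mutual
  _⊨_ : Valuation n → Formula n → Set
  v ⊨ var p     = T (v p)
  v ⊨ ¬ᶠ φ      = ¬ (v ⊨ φ)
  v ⊨ φ ∧ᶠ ψ    = (v ⊨ φ) × (v ⊨ ψ)
  v ⊨ [ π ] φ   = ∀ v′ → ⟦ π ⟧ v v′ → v′ ⊨ φ

  ⟦_⟧ : Program n → Rel (Valuation n) 0ℓ
  ⟦ + p ⟧   v v′ = v′ ≗ v [ p ≔ true ]
  ⟦ - p ⟧   v v′ = v′ ≗ v [ p ≔ false ]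
  ⟦ φ ¿ ⟧   v v′ = v′ ≗ v × v ⊨ φ
  ⟦ π ⨾ ρ ⟧ v v′ = ∃[ u ] (⟦ π ⟧ v u × ⟦ ρ ⟧ u v′)
  ⟦ π ⊔ ρ ⟧ v v′ = ⟦ π ⟧ v v′ ⊎ ⟦ ρ ⟧ v v′
  ⟦ π ⁻¹ ⟧  v v′ = ⟦ π ⟧ v′ v

⊥ᶠ ⊤ᶠ : Formula n
⊥ᶠ = var (`other 0) ∧ᶠ ¬ᶠ var (`other 0)
⊤ᶠ = ¬ᶠ ⊥ᶠ

_∨ᶠ_ _→ᶠ_ _↔ᶠ_ : Formula n → Formula n → Formula n
φ ∨ᶠ ψ = ¬ᶠ (¬ᶠ φ ∧ᶠ ¬ᶠ ψ)
φ →ᶠ ψ = ¬ᶠ (φ ∧ᶠ ¬ᶠ ψ)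
φ ↔ᶠ ψ = (φ →ᶠ ψ) ∧ᶠ (ψ →ᶠ φ)

⟨_⟩_ : Program n → Formula n → Formula n
⟨ π ⟩ φ = ¬ᶠ [ π ] ¬ᶠ φ

⋀ ⋁ : (Fin n → Formula n) → Formula n
⋀ {n} φ = foldr _∧ᶠ_ ⊤ᶠ (map φ (allFin n))
⋁ {n} φ = foldr _∨ᶠ_ ⊥ᶠ (map φ (allFin n))

skip : Program n
skip = ⊤ᶠ ¿

-- skip stands for the empty sequence and for the empty union; in particular
-- a nonempty union must not acquire skip as an extra summand.
sequence union : List (Program n) → Program n
sequence []           = skip
sequence (π ∷ [])     = π
sequence (π ∷ ρ ∷ πs) = π ⨾ sequence (ρ ∷ πs)
union []              = skip
union (π ∷ [])        = π
union (π ∷ ρ ∷ πs)    = π ⊔ union (ρ ∷ πs)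

mkTrueOne mkFalseOne mkTrueSome mkFalseSome vary : List (Prp n) → Program n
mkTrueOne P   = union (map (λ p → (¬ᶠ var p) ¿ ⨾ + p) P)
mkFalseOne P  = union (map (λ p → var p ¿ ⨾ - p) P)
mkTrueSome P  = sequence (map (λ p → + p ⊔ skip) P)
mkFalseSome P = sequence (map (λ p → - p ⊔ skip) P)
vary P        = sequence (map (λ p → + p ⊔ - p) P)

------------------------------------------------------------------------
-- Extension programs

aw inᶠ in′ : Fin n → Formula n
aw x  = var (`aw x)
inᶠ x = var (`in x)
in′ x = var (`in′ x)

r : Fin n → Fin n → Formula n
r x y = var (`r x y)

IN : List (Prp n)
IN {n} = map `in (allFin n)

makeExt[_] : Formula n → Program n
makeExt[ φ ] = vary IN ⨾ φ ¿

copy-IN : Program n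
copy-IN {n} =
  sequence (map (λ x → (inᶠ x ¿ ⨾ + `in′ x) ⊔ ((¬ᶠ inᶠ x) ¿ ⨾ - `in′ x)) (allFin n))

Well ConFree Admissible Stable Complete Grounded Preferred Naive : Formula n

Well = ⋀ λ x → inᶠ x →ᶠ aw x

ConFree = Well ∧ᶠ (⋀ λ x → ⋀ λ y → ¬ᶠ (inᶠ x ∧ᶠ inᶠ y ∧ᶠ r x y))

Admissible = ConFree ∧ᶠ
  (⋀ λ x → inᶠ x →ᶠ (⋀ λ y → (aw y ∧ᶠ r y x) →ᶠ (⋁ λ z → inᶠ z ∧ᶠ r z y)))

Stable = Well ∧ᶠ
  (⋀ λ x → aw x →ᶠ (inᶠ x ↔ᶠ ¬ᶠ (⋁ λ y → inᶠ y ∧ᶠ r y x)))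

-- As in Stable, the equivalence is required of the available arguments only.
-- With x ranging unguarded over the whole universe, an unavailable x that no
-- available argument attacks would have to be in the extension, which Well
-- forbids, and the formula would then be unsatisfiable.
Complete = ConFree ∧ᶠ
  (⋀ λ x → aw x →ᶠ
    (inᶠ x ↔ᶠ (⋀ λ y → (aw y ∧ᶠ r y x) →ᶠ (⋁ λ z → inᶠ z ∧ᶠ r z y))))

Grounded = Complete ∧ᶠ [ mkFalseOne IN ⨾ mkFalseSome IN ] ¬ᶠ Complete

Preferred = Admissible ∧ᶠ [ mkTrueOne IN ⨾ mkTrueSome IN ] ¬ᶠ Admissible

Naive = ConFree ∧ᶠ [ mkTrueOne IN ] ¬ᶠ ConFree

Rg Rg′ : Fin n → Formula n
Rg x  = inᶠ x ∨ᶠ (aw x ∧ᶠ (⋁ λ y → inᶠ y ∧ᶠ r y x))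
Rg′ x = in′ x ∨ᶠ (aw x ∧ᶠ (⋁ λ y → in′ y ∧ᶠ r y x))

IncludedInCp IncludesCp SemiStable Stage : Formula n
IncludedInCp = ⋀ λ x → Rg x →ᶠ Rg′ x
IncludesCp   = ⋀ λ x → Rg′ x →ᶠ Rg x

SemiStable = Complete ∧ᶠ
  [ copy-IN ⨾ makeExt[ Complete ] ] (IncludesCp →ᶠ IncludedInCp)

Stage = ConFree ∧ᶠ
  [ copy-IN ⨾ vary IN ⨾ ConFree ¿ ] (IncludesCp →ᶠ IncludedInCp)

IdealSet EagerSet Ideal Eager : Formula n
IdealSet = Admissible ∧ᶠ (⋀ λ x → inᶠ x →ᶠ [ makeExt[ Preferred ] ] inᶠ x)
EagerSet = Admissible ∧ᶠ (⋀ λ x → inᶠ x →ᶠ [ makeExt[ SemiStable ] ] inᶠ x)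
Ideal    = IdealSet ∧ᶠ [ mkTrueOne IN ⨾ mkTrueSome IN ] ¬ᶠ IdealSet
Eager    = EagerSet ∧ᶠ [ mkTrueOne IN ⨾ mkTrueSome IN ] ¬ᶠ EagerSet

characteristic : Semantics → Formula n
characteristic st  = Stable
characteristic co  = Complete
characteristic gr  = Grounded
characteristic pr  = Preferred
characteristic se  = SemiStable
characteristic id  = Ideal
characteristic ea  = Eager
characteristic na  = Naive
characteristic stg = Stage

makeExt : Semantics → Program n
makeExt σ = makeExt[ characteristic σ ]

------------------------------------------------------------------------
-- Encoding of rich incomplete argumentation frameworks

AW : Subset n → List (Prp n)
AW {n} A = map `aw (filter (_∈? A) (allFin n))

pairs : Relation n → List (Fin n × Fin n)
pairs {n} R = filter (λ xy → proj₂ xy ∈? R (proj₁ xy)) (cartesianProduct (allFin n) (allFin n))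

ATT : Relation n → List (Prp n)
ATT R = map (λ (x , y) → `r x y) (pairs R)

dis : Relation n → Program n
dis R = sequence (map (λ (x , y) → + `r x y ⊔ + `r y x) (pairs R))

valuation : List (Prp n) → Valuation n
valuation P p = does (member? _≟_ p P)

module _ (I : RIAF n) where
  open RIAF I

  initial : Valuation n
  initial = valuation (AW Aᶠ ++ ATT Rᶠ)

  makeComp : Program n
  makeComp = mkTrueSome (AW A?) ⨾ mkTrueSome (ATT R?) ⨾ dis R↔

{-# OPTIONS --safe #-}

-- Model checking for DL-PA is decidable, so that [π] and ⟨π⟩ can be read as
-- quantifiers over the outcomes of π also constructively. The outcomes of
-- makeComp from the initial valuation encode exactly the completions, and those
-- of vary IN exactly the sets of arguments, so it suffices that the
-- characteristic formula of σ holds in an encoding of (F , E) iff E is a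
-- σ-extension of F. Two formulas differ in substance from the definition:
-- Naive tries only extensions of E by one argument, which is enough because
-- subsets of conflict-free sets are conflict-free; Preferred maximises among
-- admissible instead of complete sets, which is the same because adding a
-- defended argument keeps a set admissible.
module Submission where

open import Defs
open import Data.Bool.Base using (Bool; true; false; T; not; if_then_else_; _∧_)
open import Data.Bool.Properties using (T-≡; T?; ¬-not; ∧-identityʳ; ∧-conicalˡ; ∧-conicalʳ)
  renaming (_≟_ to _≟ᵇ_)
open import Data.Fin.Base using (Fin; zero)
open import Data.Fin.Subset using (Subset; _∈_; _∉_; _⊆_; _⊂_; _∪_; ⁅_⁆)
open import Data.Fin.Subset.Induction using (⊃-wellFounded; Acc; acc)
open import Data.Fin.Subset.Properties using (_∈?_; x∈p∪q⁺; x∈p∪q⁻; x∈⁅x⁆; x∈⁅y⁆⇒x≡y; p⊆p∪q)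
open import Data.List.Base using (List; []; _∷_; _++_; map; allFin; foldr; cartesianProduct)
open import Data.List.Membership.DecPropositional using () renaming (_∈?_ to member?)
open import Data.List.Membership.Propositional using () renaming (_∈_ to _∈ₗ_; _∉_ to _∉ₗ_)
open import Data.List.Membership.Propositional.Properties
  using (∈-map⁺; ∈-map⁻; ∈-allFin; ∈-map∘filter⁺; ∈-map∘filter⁻; ∈-cartesianProduct⁺;
         ∈-filter⁺; ∈-filter⁻; ∈-++⁺ˡ; ∈-++⁺ʳ; ∈-++⁻)
open import Data.List.Properties using (map-id)
open import Data.List.Relation.Unary.Any using (here; there)
open import Data.Nat.Base using (ℕ; NonZero; suc)
open import Data.Product using (_×_; _,_; ∃; ∃-syntax; proj₁; proj₂; uncurry)
open import Data.Sum.Base using (_⊎_; inj₁; inj₂; [_,_]′)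
  renaming (map to map-⊎; map₁ to map-⊎₁; map₂ to map-⊎₂)
open import Data.Unit.Base using (⊤; tt)
open import Data.Vec.Base using (lookup; tabulate)
open import Data.Vec.Properties using (lookup∘tabulate; []=⇒lookup; lookup⇒[]=)
open import Function.Base using (_∘_; flip)
open import Function.Bundles using (_⇔_; mk⇔; Equivalence)
open import Level using (0ℓ)
open import Relation.Binary.Core using (Rel)
open import Relation.Binary.Definitions using (Symmetric; Decidable)
open import Relation.Binary.PropositionalEquality
  using (_≡_; _≢_; _≗_; refl; sym; trans; cong; cong₂; subst)
open import Relation.Nullary using (¬_; Dec; yes; no; does; contradiction)
open import Relation.Nullary.Decidable
  using (map′; _×-dec_; _⊎-dec_; ¬?; dec-true; dec-false; decidable-stable)
open import Relation.Unary using () renaming (_⊂_ to _⊂ᴾ_)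

private variable
  b c : Bool
  p q : Prp n
  u v w v′ w′ : Valuation n
  φ ψ : Formula n
  π ρ : Program n
  P Q : Set
  x y a : Fin n
  E E′ : Subset n

-- Updating a single variable

≔-same : (v : Valuation n) (p : Prp n) → (v [ p ≔ b ]) p ≡ b
≔-same {b = b} v p = cong (if_then b else v p) (dec-true (p ≟ p) refl)

≔-other : (v : Valuation n) → q ≢ p → (v [ p ≔ b ]) q ≡ v q
≔-other {q = q} {p = p} {b = b} v q≢p =
  cong (if_then b else v q) (dec-false (q ≟ p) q≢p)

≔-cong : (p : Prp n) → v ≗ w → v [ p ≔ b ] ≗ w [ p ≔ b ]
≔-cong {b = b} p v≗w q = cong (if does (q ≟ p) then b else_) (v≗w q)

≔-redundant : v p ≡ b → v [ p ≔ b ] ≗ v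
≔-redundant {p = p} vp≡b q with q ≟ p
... | yes refl = sym vp≡b
... | no  _    = refl

≔-overwrite : (v : Valuation n) (p : Prp n) → (v [ p ≔ c ]) [ p ≔ b ] ≗ v [ p ≔ b ]
≔-overwrite v p q with q ≟ p
... | yes _ = refl
... | no  _ = refl

-- Programs fix their outcomes only up to `≗`, which does not yield equality of functions here, so
-- predicates on valuations have to be shown invariant under it.
Respects≗ : (Valuation n → Set) → Set
Respects≗ P = ∀ {v w} → v ≗ w → P v → P w

mutual
  ⊨-resp-≗ : (φ : Formula n) → Respects≗ (_⊨ φ)
  ⊨-resp-≗ (var p)   v≗w h       = subst T (v≗w p) h
  ⊨-resp-≗ (¬ᶠ φ)    v≗w h       = h ∘ ⊨-resp-≗ φ (sym ∘ v≗w)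
  ⊨-resp-≗ (φ ∧ᶠ ψ)  v≗w (h , k) = ⊨-resp-≗ φ v≗w h , ⊨-resp-≗ ψ v≗w k
  ⊨-resp-≗ ([ π ] φ) v≗w h u s   = h u (⟦⟧-resp-≗ π (sym ∘ v≗w) (λ _ → refl) s)

  ⟦⟧-resp-≗ : (π : Program n) → v ≗ v′ → w ≗ w′ → ⟦ π ⟧ v w → ⟦ π ⟧ v′ w′
  ⟦⟧-resp-≗ (+ p) e f s q = trans (sym (f q)) (trans (s q) (≔-cong p e q))
  ⟦⟧-resp-≗ (- p) e f s q = trans (sym (f q)) (trans (s q) (≔-cong p e q))
  ⟦⟧-resp-≗ (φ ¿) e f (s , h) =
    (λ q → trans (sym (f q)) (trans (s q) (e q))) , ⊨-resp-≗ φ e h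
  ⟦⟧-resp-≗ (π ⨾ ρ) e f (u , s , t) =
    u , ⟦⟧-resp-≗ π e (λ _ → refl) s , ⟦⟧-resp-≗ ρ (λ _ → refl) f t
  ⟦⟧-resp-≗ (π ⊔ ρ) e f (inj₁ s) = inj₁ (⟦⟧-resp-≗ π e f s)
  ⟦⟧-resp-≗ (π ⊔ ρ) e f (inj₂ s) = inj₂ (⟦⟧-resp-≗ ρ e f s)
  ⟦⟧-resp-≗ (π ⁻¹) e f s = ⟦⟧-resp-≗ π f e s

-- Decidability of model checking

Post Pre : Program n → (Valuation n → Set) → Valuation n → Set
Post π P v = ∃[ w ] (⟦ π ⟧ v w × P w)
Pre  π P w = ∃[ v ] (⟦ π ⟧ v w × P v)

Post-resp-≗ : (π : Program n) (P : Valuation n → Set) → Respects≗ (Post π P)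
Post-resp-≗ π P e (w , s , h) = w , ⟦⟧-resp-≗ π e (λ _ → refl) s , h

Pre-resp-≗ : (π : Program n) (P : Valuation n → Set) → Respects≗ (Pre π P)
Pre-resp-≗ π P e (w , s , h) = w , ⟦⟧-resp-≗ π (λ _ → refl) e s , h

-- An assignment has at most two predecessors up to ≗, one for each value that
-- p may have had before.
assign-pre? : ∀ {P : Valuation n → Set} → Respects≗ P → (∀ v → Dec (P v)) →
  ∀ p b w → Dec (∃[ v ] (w ≗ v [ p ≔ b ] × P v))
assign-pre? {P = P} resp P? p b w = map′ to from
  ((w p ≟ᵇ b) ×-dec (P? (w [ p ≔ true ]) ⊎-dec P? (w [ p ≔ false ])))
  where
  restore : ∀ c → w p ≡ b → w ≗ (w [ p ≔ c ]) [ p ≔ b ]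
  restore c wp≡b q = sym (trans (≔-overwrite w p q) (≔-redundant wp≡b q))

  to : w p ≡ b × (P (w [ p ≔ true ]) ⊎ P (w [ p ≔ false ])) →
       ∃[ v ] (w ≗ v [ p ≔ b ] × P v)
  to (e , inj₁ h) = _ , restore true e , h
  to (e , inj₂ h) = _ , restore false e , h

  from : ∃[ v ] (w ≗ v [ p ≔ b ] × P v) →
         w p ≡ b × (P (w [ p ≔ true ]) ⊎ P (w [ p ≔ false ]))
  from (v , e , h) = trans (e p) (≔-same v p) , split (v p) refl
    where
    undo : v p ≡ c → v ≗ w [ p ≔ c ]
    undo vp≡c q = sym (trans (≔-cong p e q)
      (trans (≔-overwrite v p q) (≔-redundant vp≡c q)))

    split : ∀ c → v p ≡ c → P (w [ p ≔ true ]) ⊎ P (w [ p ≔ false ])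
    split true  vp≡c = inj₁ (resp (undo vp≡c) h)
    split false vp≡c = inj₂ (resp (undo vp≡c) h)

mutual
  _⊨?_ : (v : Valuation n) (φ : Formula n) → Dec (v ⊨ φ)
  v ⊨? var p     = T? (v p)
  v ⊨? (¬ᶠ φ)    = ¬? (v ⊨? φ)
  v ⊨? (φ ∧ᶠ ψ)  = (v ⊨? φ) ×-dec (v ⊨? ψ)
  -- A box is decided by searching for a counterexample; the decidability of `φ` removes the double
  -- negation that this leaves.
  v ⊨? ([ π ] φ) = map′
    (λ ¬∃ w s → decidable-stable (w ⊨? φ) λ ¬h → ¬∃ (w , s , ¬h))
    (λ { h (w , s , ¬h) → ¬h (h w s) })
    (¬? (post? π (⊨-resp-≗ (¬ᶠ φ)) (λ w → ¬? (w ⊨? φ)) v))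

  -- Outcomes are not enumerated: `P` acts as a continuation, so that for `π ⨾ ρ` the question about
  -- `π` is asked with `Post ρ P` as its goal. The induction is simultaneous with `pre?` because
  -- `⁻¹` exchanges the two.
  post? : (π : Program n) {P : Valuation n → Set} → Respects≗ P →
    (∀ w → Dec (P w)) → ∀ v → Dec (Post π P v)
  post? (+ p) resp P? v =
    map′ (λ h → _ , (λ _ → refl) , h) (λ { (_ , e , h) → resp e h }) (P? _)
  post? (- p) resp P? v =
    map′ (λ h → _ , (λ _ → refl) , h) (λ { (_ , e , h) → resp e h }) (P? _)
  post? (φ ¿) resp P? v =
    map′ (λ { (k , h) → v , ((λ _ → refl) , k) , h })
         (λ { (_ , (e , k) , h) → k , resp e h })
         ((v ⊨? φ) ×-dec P? v)
  post? (π ⨾ ρ) {P} resp P? v =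
    map′ (λ { (u , s , w , t , h) → w , (u , s , t) , h })
         (λ { (w , (u , s , t) , h) → u , s , w , t , h })
         (post? π (Post-resp-≗ ρ P) (post? ρ resp P?) v)
  post? (π ⊔ ρ) resp P? v =
    map′ [ (λ { (w , s , h) → w , inj₁ s , h }) , (λ { (w , s , h) → w , inj₂ s , h }) ]′
         (λ { (w , inj₁ s , h) → inj₁ (w , s , h) ; (w , inj₂ s , h) → inj₂ (w , s , h) })
         (post? π resp P? v ⊎-dec post? ρ resp P? v)
  post? (π ⁻¹) resp P? v = pre? π resp P? v

  pre? : (π : Program n) {P : Valuation n → Set} → Respects≗ P →
    (∀ v → Dec (P v)) → ∀ w → Dec (Pre π P w)
  pre? (+ p) resp P? w = assign-pre? resp P? p true w
  pre? (- p) resp P? w = assign-pre? resp P? p false w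
  pre? (φ ¿) resp P? w =
    map′ (λ { (k , h) → w , ((λ _ → refl) , k) , h })
         (λ { (v , (e , k) , h) → ⊨-resp-≗ φ (sym ∘ e) k , resp (sym ∘ e) h })
         ((w ⊨? φ) ×-dec P? w)
  pre? (π ⨾ ρ) {P} resp P? w =
    map′ (λ { (u , t , v , s , h) → v , (u , s , t) , h })
         (λ { (v , (u , s , t) , h) → u , t , v , s , h })
         (pre? ρ (Pre-resp-≗ π P) (pre? π resp P?) w)
  pre? (π ⊔ ρ) resp P? w =
    map′ [ (λ { (v , s , h) → v , inj₁ s , h }) , (λ { (v , s , h) → v , inj₂ s , h }) ]′
         (λ { (v , inj₁ s , h) → inj₁ (v , s , h) ; (v , inj₂ s , h) → inj₂ (v , s , h) })
         (pre? π resp P? w ⊎-dec pre? ρ resp P? w)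
  pre? (π ⁻¹) resp P? w = post? π resp P? w

-- Sequences and unions of programs

-- `sequence` puts no `skip` after its last program, so for an empty tail the `skip` has to be
-- absorbed by invariance under `≗`.
sequence-cons : (π : Program n) (πs : List (Program n)) →
  ⟦ π ⟧ v u → ⟦ sequence πs ⟧ u w → ⟦ sequence (π ∷ πs) ⟧ v w
sequence-cons π []       s (e , _) = ⟦⟧-resp-≗ π (λ _ → refl) (sym ∘ e) s
sequence-cons π (_ ∷ _)  s t       = _ , s , t

skip⁺ : w ≗ v → ⟦ skip ⟧ v w
skip⁺ e = e , λ (h , ¬h) → ¬h h

module _ {X : Set} (π : X → Program n) where

  -- A loop invariant. The step may use `x ∈ₗ L`, which is how frame properties learn that a
  -- variable outside the list is never assigned.
  preserve : {P : Valuation n → Set} → Respects≗ P → (L : List X) →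
    (∀ {x u u′} → x ∈ₗ L → ⟦ π x ⟧ u u′ → P u → P u′) →
    ⟦ sequence (map π L) ⟧ v w → P v → P w
  preserve resp []           _    (e , _)     h = resp (sym ∘ e) h
  preserve resp (x ∷ [])     step s           h = step (here refl) s h
  preserve resp (x ∷ y ∷ L)  step (u , s , t) h =
    preserve resp (y ∷ L) (step ∘ there) t (step (here refl) s h)

  -- Step `x` brings about `P x`, and no later step destroys it.
  establish : {P : X → Valuation n → Set} → (∀ x → Respects≗ (P x)) → (L : List X) →
    (∀ {x u u′} → ⟦ π x ⟧ u u′ → P x u′) →
    (∀ {x y u u′} → ⟦ π y ⟧ u u′ → P x u → P x u′) →
    ⟦ sequence (map π L) ⟧ v w → ∀ {x} → x ∈ₗ L → P x w
  establish resp (x ∷ [])    est _    s           (here refl) = est s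
  establish resp (x ∷ y ∷ L) est keep (u , s , t) (here refl) =
    preserve (resp x) (y ∷ L) (λ _ → keep) t (est s)
  establish resp (x ∷ y ∷ L) est keep (u , s , t) (there x∈L) =
    establish resp (y ∷ L) est keep t x∈L

  -- If step x can give the variable target x its final value, whatever part of
  -- the way from v to w has been covered, then the whole sequence leads from v
  -- to w.
  steer : (target : X → Prp n) (L : List X) →
    (∀ {x} → x ∈ₗ L → ∀ u → (∀ q → u q ≡ v q ⊎ u q ≡ w q) →
      ⟦ π x ⟧ u (u [ target x ≔ w (target x) ])) →
    (∀ q → q ∉ₗ map target L → w q ≡ v q) →
    ⟦ sequence (map π L) ⟧ v w
  steer target [] _ frame = skip⁺ λ q → frame q λ ()
  steer {v = v} {w = w} target (x ∷ L) step frame =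
    sequence-cons (π x) (map π L) (step (here refl) v λ _ → inj₁ refl)
      (steer target L
        (λ x∈L u between → step (there x∈L) u (λ q → widen q (between q))) frame′)
    where
    v₁ = v [ target x ≔ w (target x) ]

    -- The new starting point `v₁` has the value of `w` at the target and that of `v` elsewhere, so
    -- whatever lies between `v₁` and `w` also lies between `v` and `w`.
    widen : ∀ q {c} → c ≡ v₁ q ⊎ c ≡ w q → c ≡ v q ⊎ c ≡ w q
    widen q (inj₂ e) = inj₂ e
    widen q (inj₁ e) with q ≟ target x
    ... | yes refl = inj₂ e
    ... | no  _    = inj₁ e

    frame′ : ∀ q → q ∉ₗ map target L → w q ≡ v₁ q
    frame′ q q∉ with q ≟ target x
    ... | yes refl = refl
    ... | no  q≢   = frame q λ { (here e) → q≢ e ; (there q∈) → q∉ q∈ }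

  union⁺ : ∀ {x} (L : List X) → x ∈ₗ L → ⟦ π x ⟧ v w → ⟦ union (map π L) ⟧ v w
  union⁺ (x ∷ [])    (here refl) s = s
  union⁺ (x ∷ y ∷ L) (here refl) s = inj₁ s
  union⁺ (x ∷ y ∷ L) (there x∈L) s = inj₂ (union⁺ (y ∷ L) x∈L s)

  -- The empty union is `skip`, which runs without choosing a member; `y ∈ₗ L` excludes it.
  union⁻ : ∀ {y} (L : List X) → y ∈ₗ L →
    ⟦ union (map π L) ⟧ v w → ∃[ x ] (x ∈ₗ L × ⟦ π x ⟧ v w)
  union⁻ (x ∷ [])     _ s        = x , here refl , s
  union⁻ (x ∷ z ∷ L)  _ (inj₁ s) = x , here refl , s
  union⁻ (x ∷ z ∷ L)  _ (inj₂ s) with union⁻ (z ∷ L) (here refl) s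
  ... | x′ , x′∈ , s′ = x′ , there x′∈ , s′

-- assign, literal, mkSome and mkOne treat the variants True and False of the
-- programs at once: mkSome true is mkTrueSome, mkOne false is mkFalseOne, etc.
assign : Bool → Prp n → Program n
assign true  p = + p
assign false p = - p

literal : Bool → Prp n → Formula n
literal true  p = var p
literal false p = ¬ᶠ var p

mkSome mkOne : Bool → List (Prp n) → Program n
mkSome b P = sequence (map (λ p → assign b p ⊔ skip) P)
mkOne  b P = union (map (λ p → literal (not b) p ¿ ⨾ assign b p) P)

assign⁺ : ∀ b → w ≗ v [ p ≔ b ] → ⟦ assign b p ⟧ v w
assign⁺ true  e = e
assign⁺ false e = e

assign⁻ : ∀ b → ⟦ assign b p ⟧ v w → w ≗ v [ p ≔ b ]
assign⁻ true  e = e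
assign⁻ false e = e

T⇒≡ : T b → b ≡ true
T⇒≡ = Equivalence.to T-≡

≡⇒T : b ≡ true → T b
≡⇒T = Equivalence.from T-≡

literal⁺ : ∀ b → v p ≡ b → v ⊨ literal b p
literal⁺ true  e = ≡⇒T e
literal⁺ false e = λ t → contradiction (trans (sym e) (T⇒≡ t)) λ ()

literal⁻ : ∀ b → v ⊨ literal b p → v p ≡ b
literal⁻ true  h = T⇒≡ h
literal⁻ false h = ¬-not (h ∘ ≡⇒T)

∉-map-id⁻ : (P : List (Prp n)) → q ∉ₗ map (λ p → p) P → q ∉ₗ P
∉-map-id⁻ P = subst (_ ∉ₗ_) (map-id P)

unchanged : w ≗ v [ p ≔ b ] → q ≢ p → w q ≡ v q
unchanged {v = v} e q≢p = trans (e _) (≔-other v q≢p)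

∈∉⇒≢ : {P : List (Prp n)} → p ∈ₗ P → q ∉ₗ P → q ≢ p
∈∉⇒≢ p∈P q∉P refl = q∉P p∈P

≡-resp-≗ : Respects≗ {n} (λ u → u q ≡ c)
≡-resp-≗ e h = trans (sym (e _)) h

-- Outcomes of the programs that vary a list of variables

vary-frame : (P : List (Prp n)) → ⟦ vary P ⟧ v w → q ∉ₗ P → w q ≡ v q
vary-frame P s q∉P = preserve _ ≡-resp-≗ P step s refl
  where
  step : ∀ {p u u′} → p ∈ₗ P → ⟦ + p ⊔ - p ⟧ u u′ → u _ ≡ _ → u′ _ ≡ _
  step p∈P (inj₁ e) h = trans (unchanged e (∈∉⇒≢ p∈P q∉P)) h
  step p∈P (inj₂ e) h = trans (unchanged e (∈∉⇒≢ p∈P q∉P)) h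

vary-reaches : (P : List (Prp n)) → (∀ q → q ∉ₗ P → w q ≡ v q) → ⟦ vary P ⟧ v w
vary-reaches {w = w} P frame = steer _ (λ p → p) P
  (λ {p} _ u _ → choose u p (w p)) (λ q → frame q ∘ ∉-map-id⁻ P)
  where
  choose : ∀ u p b → ⟦ + p ⊔ - p ⟧ u (u [ p ≔ b ])
  choose u p true  = inj₁ λ _ → refl
  choose u p false = inj₂ λ _ → refl

mkSome-frame : ∀ b (P : List (Prp n)) → ⟦ mkSome b P ⟧ v w → q ∉ₗ P → w q ≡ v q
mkSome-frame b P s q∉P = preserve _ ≡-resp-≗ P step s refl
  where
  step : ∀ {p u u′} → p ∈ₗ P → ⟦ assign b p ⊔ skip ⟧ u u′ → u _ ≡ _ → u′ _ ≡ _
  step p∈P (inj₁ e)       h = trans (unchanged (assign⁻ b e) (∈∉⇒≢ p∈P q∉P)) h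
  step p∈P (inj₂ (e , _)) h = trans (e _) h

assign-monotone : ∀ q → w ≗ v [ p ≔ b ] → v q ≡ b → w q ≡ b
assign-monotone {p = p} q e h with e q
-- The equation `e q` has been abstracted first, so that this case split reduces the update inside
-- its type as well.
... | eq with q ≟ p
...   | yes _ = eq
...   | no  _ = trans eq h

mkSome-monotone : ∀ b (P : List (Prp n)) → ⟦ mkSome b P ⟧ v w → v q ≡ b → w q ≡ b
mkSome-monotone {q = q} b P s h = preserve _ ≡-resp-≗ P step s h
  where
  step : ∀ {p u u′} → p ∈ₗ P → ⟦ assign b p ⊔ skip ⟧ u u′ → u q ≡ b → u′ q ≡ b
  step _ (inj₁ e)       h = assign-monotone q (assign⁻ b e) h
  step _ (inj₂ (e , _)) h = trans (e _) h

mkSome-reaches : ∀ b (P : List (Prp n)) → (∀ q → q ∉ₗ P → w q ≡ v q) →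
  (∀ q → v q ≡ b → w q ≡ b) → ⟦ mkSome b P ⟧ v w
mkSome-reaches {w = w} {v = v} b P frame mono = steer _ (λ p → p) P choose
  (λ q → frame q ∘ ∉-map-id⁻ P)
  where
  choose : ∀ {p} → p ∈ₗ P → ∀ u → (∀ q → u q ≡ v q ⊎ u q ≡ w q) →
    ⟦ assign b p ⊔ skip ⟧ u (u [ p ≔ w p ])
  choose {p} _ u between with w p ≟ᵇ b
  ... | yes e = inj₁ (assign⁺ b λ q → cong (λ c → (u [ p ≔ c ]) q) e)
  -- By `mono`, `v p` differs from `b` as well, so `v p` and `w p` coincide; `u p` is one of them
  -- and needs no assignment.
  ... | no wp≢b = inj₂ (skip⁺ (≔-redundant
    ([ (λ e → trans (trans e (¬-not (wp≢b ∘ mono p))) (sym (¬-not wp≢b))) , (λ e → e) ]′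
      (between p))))

mkOne⁻ : ∀ b {P : List (Prp n)} → p ∈ₗ P → ⟦ mkOne b P ⟧ v w →
  ∃[ q ] (q ∈ₗ P × v q ≡ not b × w ≗ v [ q ≔ b ])
mkOne⁻ b {P} p∈P s with union⁻ _ P p∈P s
... | q , q∈P , u , (e , h) , t =
  q , q∈P , literal⁻ (not b) h , λ x → trans (assign⁻ b t x) (≔-cong q e x)

mkOne⁺ : ∀ b {P : List (Prp n)} → p ∈ₗ P → v p ≡ not b → w ≗ v [ p ≔ b ] → ⟦ mkOne b P ⟧ v w
mkOne⁺ b {P} p∈P h e = union⁺ _ P p∈P (_ , ((λ _ → refl) , literal⁺ (not b) h) , assign⁺ b e)

-- `mkOne` forces one variable to change and `mkSome` lets others follow, so the outcomes are
-- exactly the strict enlargements for `b = true` and the strict reductions for `b = false`.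
grow : Bool → List (Prp n) → Program n
grow b P = mkOne b P ⨾ mkSome b P

grow⁻ : ∀ b {P : List (Prp n)} → p ∈ₗ P → ⟦ grow b P ⟧ v w →
  (∀ q → q ∉ₗ P → w q ≡ v q) × (∀ q → v q ≡ b → w q ≡ b) ×
  ∃[ q ] (q ∈ₗ P × v q ≡ not b × w q ≡ b)
grow⁻ {v = v} b {P} p∈P (u , s , t) with mkOne⁻ b p∈P s
... | p , p∈P , vp , e =
    (λ q q∉P → trans (mkSome-frame b P t q∉P) (unchanged e (∈∉⇒≢ p∈P q∉P)))
  , (λ q h → mkSome-monotone b P t (assign-monotone q e h))
  , p , p∈P , vp , mkSome-monotone b P t (trans (e p) (≔-same v p))

grow⁺ : ∀ b {P : List (Prp n)} → (∀ q → q ∉ₗ P → w q ≡ v q) → (∀ q → v q ≡ b → w q ≡ b) →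
  p ∈ₗ P → v p ≡ not b → w p ≡ b → ⟦ grow b P ⟧ v w
grow⁺ {w = w} {v = v} {p = p} b {P} frame mono p∈P vp wp =
  -- The witness `p` of strictness is flipped first; `mkSome` supplies the other changes.
  v [ p ≔ b ] , mkOne⁺ b p∈P vp (λ _ → refl) , mkSome-reaches b P frame′ mono′
  where
  frame′ : ∀ q → q ∉ₗ P → w q ≡ (v [ p ≔ b ]) q
  frame′ q q∉P = trans (frame q q∉P) (sym (≔-other v (∈∉⇒≢ p∈P q∉P)))

  mono′ : ∀ q → (v [ p ≔ b ]) q ≡ b → w q ≡ b
  mono′ q h with q ≟ p
  ... | yes refl = wp
  ... | no  _    = mono q h

-- Translating formulas into propositions

-- A record rather than _⇔_, so that φ can be inferred.
record Translates (v : Valuation n) (φ : Formula n) (P : Set) : Set where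
  constructor translation
  field
    from⊨ : v ⊨ φ → P
    to⊨   : P → v ⊨ φ

open Translates

via : (P → Q) → (Q → P) → Translates v φ P → Translates v φ Q
via f g t = translation (f ∘ from⊨ t) (to⊨ t ∘ g)

-- Translated propositions inherit stability from the decidability of `φ`; this replaces classical
-- reasoning about attacks and ranges.
stable : Translates v φ P → ¬ ¬ P → P
stable {v = v} {φ = φ} t ¬¬p =
  from⊨ t (decidable-stable (v ⊨? φ) λ ¬h → ¬¬p (¬h ∘ to⊨ t))

infixr 3 _∧ᵗ_ _∨ᵗ_ _→ᵗ_
infix  4 _↔ᵗ_

-- The second translation may assume the first proposition: attack variables are meaningful only
-- between available arguments, and earlier conjuncts or premises supply that availability.
_∧ᵗ_ : Translates v φ P → (P → Translates v ψ Q) → Translates v (φ ∧ᶠ ψ) (P × Q)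
s ∧ᵗ t = translation
  (λ (h , k) → from⊨ s h , from⊨ (t (from⊨ s h)) k)
  (λ (p , q) → to⊨ s p , to⊨ (t p) q)

¬ᵗ_ : Translates v φ P → Translates v (¬ᶠ φ) (¬ P)
¬ᵗ t = translation (λ ¬h → ¬h ∘ to⊨ t) (λ ¬p → ¬p ∘ from⊨ t)

_∨ᵗ_ : Translates v φ P → Translates v ψ Q → Translates v (φ ∨ᶠ ψ) (P ⊎ Q)
_∨ᵗ_ {v = v} {φ = φ} {ψ = ψ} s t = translation to from
  where
  to : v ⊨ φ ∨ᶠ ψ → _
  to h with v ⊨? φ
  ... | yes k = inj₁ (from⊨ s k)
  ... | no ¬k = inj₂ (from⊨ t (decidable-stable (v ⊨? ψ) λ ¬l → h (¬k , ¬l)))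

  from : _ → v ⊨ φ ∨ᶠ ψ
  from (inj₁ p) (¬k , _) = ¬k (to⊨ s p)
  from (inj₂ q) (_ , ¬l) = ¬l (to⊨ t q)

_→ᵗ_ : Translates v φ P → (P → Translates v ψ Q) → Translates v (φ →ᶠ ψ) (P → Q)
_→ᵗ_ {v = v} {ψ = ψ} s t = translation
  (λ h p → from⊨ (t p) (decidable-stable (v ⊨? ψ) λ ¬k → h (to⊨ s p , ¬k)))
  (λ f (h , ¬k) → ¬k (to⊨ (t (from⊨ s h)) (f (from⊨ s h))))

_↔ᵗ_ : Translates v φ P → Translates v ψ Q → Translates v (φ ↔ᶠ ψ) (P ⇔ Q)
s ↔ᵗ t = via (λ (f , g) → mk⇔ f g) (λ e → Equivalence.to e , Equivalence.from e)
  ((s →ᵗ λ _ → t) ∧ᵗ λ _ → t →ᵗ λ _ → s)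

module _ {X : Set} {f : X → Formula n} {P : X → Set} (t : ∀ x → Translates v (f x) (P x)) where

  all⁻ : ∀ {x} (L : List X) → v ⊨ foldr _∧ᶠ_ ⊤ᶠ (map f L) → x ∈ₗ L → P x
  all⁻ (y ∷ L) (h , _) (here refl) = from⊨ (t y) h
  all⁻ (y ∷ L) (_ , k) (there x∈L) = all⁻ L k x∈L

  all⁺ : (L : List X) → (∀ x → P x) → v ⊨ foldr _∧ᶠ_ ⊤ᶠ (map f L)
  all⁺ []      h = λ (h , ¬h) → ¬h h
  all⁺ (x ∷ L) h = to⊨ (t x) (h x) , all⁺ L h

  some⁻ : (L : List X) → v ⊨ foldr _∨ᶠ_ ⊥ᶠ (map f L) → ∃ P
  some⁻ []      (h , ¬h) = contradiction h ¬h
  some⁻ (x ∷ L) h with v ⊨? f x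
  ... | yes k = x , from⊨ (t x) k
  ... | no ¬k = some⁻ L (decidable-stable (v ⊨? foldr _∨ᶠ_ ⊥ᶠ (map f L)) λ ¬l → h (¬k , ¬l))

  some⁺ : ∀ {x} (L : List X) → x ∈ₗ L → P x → v ⊨ foldr _∨ᶠ_ ⊥ᶠ (map f L)
  some⁺ (y ∷ L) (here refl) h (¬k , _) = ¬k (to⊨ (t y) h)
  some⁺ (y ∷ L) (there x∈L) h (_ , ¬l) = ¬l (some⁺ L x∈L h)

⋀ᵗ : {f : Fin n → Formula n} {P : Fin n → Set} → (∀ x → Translates v (f x) (P x)) →
  Translates v (⋀ f) (∀ x → P x)
⋀ᵗ t = translation (λ h x → all⁻ t (allFin _) h (∈-allFin x)) (all⁺ t (allFin _))

⋁ᵗ : {f : Fin n → Formula n} {P : Fin n → Set} → (∀ x → Translates v (f x) (P x)) →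
  Translates v (⋁ f) (∃ P)
⋁ᵗ t = translation (some⁻ t (allFin _)) (λ (x , h) → some⁺ t (allFin _) (∈-allFin x) h)

-- The outcomes of running π from v are described by the indices s with Ok s,
-- R s w saying that w is an outcome described by s.
record Outcomes (v : Valuation n) (π : Program n) {S : Set}
                (Ok : S → Set) (R : S → Valuation n → Set) : Set where
  constructor outcomes
  field
    describe : ∀ {w} → ⟦ π ⟧ v w → ∃[ s ] (Ok s × R s w)
    realise  : ∀ s → Ok s → ∃[ w ] (⟦ π ⟧ v w × R s w)

module _ {S : Set} {Ok : S → Set} {R : S → Valuation n → Set} {Q : S → Set}
         (o : Outcomes v π Ok R)
         (t : ∀ {s w} → Ok s → R s w → Translates w φ (Q s)) where

  open Outcomes o

  □ᵗ : Translates v ([ π ] φ) (∀ s → Ok s → Q s)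
  □ᵗ = translation to from
    where
    to : v ⊨ [ π ] φ → ∀ s → Ok s → Q s
    to h s ok with realise s ok
    ... | w , π-w , sw = from⊨ (t ok sw) (h w π-w)

    from : (∀ s → Ok s → Q s) → v ⊨ [ π ] φ
    from h w π-w with describe π-w
    ... | s , ok , sw = to⊨ (t ok sw) (h s ok)

  ◇ᵗ : Translates v (⟨ π ⟩ φ) (∃[ s ] (Ok s × Q s))
  ◇ᵗ = translation to from
    where
    to : v ⊨ ⟨ π ⟩ φ → ∃[ s ] (Ok s × Q s)
    -- The diamond is a negated box, so its witness has to be found by search.
    to h with post? π (⊨-resp-≗ φ) (_⊨? φ) v
    ... | no ¬∃ = contradiction (λ w π-w k → ¬∃ (w , π-w , k)) h
    ... | yes (w , π-w , k) with describe π-w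
    ...   | s , ok , sw = s , ok , from⊨ (t ok sw) k

    from : ∃[ s ] (Ok s × Q s) → v ⊨ ⟨ π ⟩ φ
    from (s , ok , h) k with realise s ok
    ... | w , π-w , sw = k w π-w (to⊨ (t ok sw) h)

□-⨾ᵗ : Translates v ([ π ] [ ρ ] φ) P → Translates v ([ π ⨾ ρ ] φ) P
□-⨾ᵗ t = translation
  (λ h → from⊨ t λ u s w s′ → h w (u , s , s′))
  (λ p w (u , s , s′) → to⊨ t p u s w s′)

◇-⨾ᵗ : Translates v (⟨ π ⟩ ⟨ ρ ⟩ φ) P → Translates v (⟨ π ⨾ ρ ⟩ φ) P
◇-⨾ᵗ t = translation
  (λ h → from⊨ t λ k → h λ w (u , s , s′) l → k u s λ m → m w s′ l)
  (λ p k → to⊨ t p λ u s l → l λ w s′ m → k w (u , s , s′) m)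

-- Valuations as encodings of frameworks and of sets of arguments

-- Attacks from or to arguments that are not available are left free, since
-- makeComp does not control them.
record _∼_ (v : Valuation n) (F : AF n) : Set where
  open AF F
  field
    aw≡ : ∀ x → v (`aw x) ≡ lookup Arg x
    r≡  : x ∈ Arg → y ∈ Arg → v (`r x y) ≡ lookup (Att x) y

-- The family `p` is a parameter so that the variables `in` and their copies `in′` are treated
-- alike.
Encodes : (Fin n → Prp n) → Valuation n → Subset n → Set
Encodes p v E = ∀ x → v (p x) ≡ lookup E x

decode : (Fin n → Prp n) → Valuation n → Subset n
decode p v = tabulate (v ∘ p)

decode-encodes : (p : Fin n → Prp n) (v : Valuation n) → Encodes p v (decode p v)
decode-encodes p v x = sym (lookup∘tabulate (v ∘ p) x)

∈-varᵗ : v p ≡ lookup E x → Translates v (var p) (x ∈ E)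
∈-varᵗ {E = E} {x = x} e = translation
  (λ t → lookup⇒[]= x E (trans (sym e) (T⇒≡ t)))
  (λ x∈E → ≡⇒T (trans e ([]=⇒lookup x∈E)))

∉⇒lookup : x ∉ E → lookup E x ≡ false
∉⇒lookup {x = x} {E = E} x∉E = ¬-not (x∉E ∘ lookup⇒[]= x E)

lookup⇒∉ : lookup E x ≡ false → x ∉ E
lookup⇒∉ e x∈E = contradiction (trans (sym e) ([]=⇒lookup x∈E)) λ ()

≡true-ext : (b ≡ true → c ≡ true) → (c ≡ true → b ≡ true) → b ≡ c
≡true-ext {b = true}              f _ = sym (f refl)
≡true-ext {b = false} {c = false} _ _ = refl
≡true-ext {b = false} {c = true}  _ g = g refl

Unchanged : Valuation n → Valuation n → Set
Unchanged v w = ∀ q → q ∉ₗ IN → w q ≡ v q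

`in∈IN : (x : Fin n) → `in x ∈ₗ IN
`in∈IN x = ∈-map⁺ `in (∈-allFin x)

`aw∉IN : (x : Fin n) → `aw x ∉ₗ IN
`aw∉IN x h with ∈-map⁻ `in h
... | _ , _ , ()

`r∉IN : (x y : Fin n) → `r x y ∉ₗ IN
`r∉IN x y h with ∈-map⁻ `in h
... | _ , _ , ()

`in′∉IN : (x : Fin n) → `in′ x ∉ₗ IN
`in′∉IN x h with ∈-map⁻ `in h
... | _ , _ , ()

∼-unchanged : {F : AF n} → Unchanged v w → v ∼ F → w ∼ F
∼-unchanged h v∼F = record
  { aw≡ = λ x → trans (h _ (`aw∉IN x)) (aw≡ x)
  ; r≡  = λ x∈A y∈A → trans (h _ (`r∉IN _ _)) (r≡ x∈A y∈A)
  } where open _∼_ v∼F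

overwrite : Valuation n → Subset n → Valuation n
overwrite v E (`in x) = lookup E x
overwrite v E q       = v q

overwrite-unchanged : (v : Valuation n) (E : Subset n) → Unchanged v (overwrite v E)
overwrite-unchanged v E (`in x)    q∉IN = contradiction (`in∈IN x) q∉IN
overwrite-unchanged v E (`aw _)    _    = refl
overwrite-unchanged v E (`in′ _)   _    = refl
overwrite-unchanged v E (`r _ _)   _    = refl
overwrite-unchanged v E (`other _) _    = refl

Into : Valuation n → Subset n → Valuation n → Set
Into v E w = Unchanged v w × Encodes `in w E

-- Formulas for conflict-free, admissible, complete and stable sets

module _ (F : AF n) where

  open AF F

  -- All encodings `v` of `F` are quantified over, because programs nested in a formula evaluate its
  -- subformulas at other valuations.
  Characterises : Formula n → (Subset n → Set) → Set
  Characterises φ X = ∀ {v E} → v ∼ F → Encodes `in v E → Translates v φ (X E)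

  -- `vary IN` reaches every set of arguments and leaves the encoding of `F` alone, so the test lets
  -- through precisely the sets with `X`.
  makeExt-outcomes : {X : Subset n → Set} → Characterises φ X → v ∼ F →
    Outcomes v makeExt[ φ ] X (Into v)
  makeExt-outcomes {φ = φ} {v = v} {X = X} char v∼F = outcomes describe realise
    where
    describe : ∀ {w} → ⟦ makeExt[ φ ] ⟧ v w → ∃[ E ] (X E × Into v E w)
    describe {w} (u , s , e , h) =
        decode `in w
      , from⊨ (char (∼-unchanged frame v∼F) (decode-encodes `in w))
              (⊨-resp-≗ φ (sym ∘ e) h)
      , frame , decode-encodes `in w
      where
      frame : Unchanged v w
      frame q q∉ = trans (e q) (vary-frame IN s q∉)

    realise : ∀ E → X E → ∃[ w ] (⟦ makeExt[ φ ] ⟧ v w × Into v E w)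
    realise E h = overwrite v E
      , (_ , vary-reaches IN (overwrite-unchanged v E)
           , (λ _ → refl) , to⊨ (char (∼-unchanged (overwrite-unchanged v E) v∼F) (λ _ → refl)) h)
      , overwrite-unchanged v E , (λ _ → refl)

  module _ {v : Valuation n} (v∼F : v ∼ F) where

    open _∼_ v∼F

    awᵗ : ∀ x → Translates v (aw x) (x ∈ Arg)
    awᵗ x = ∈-varᵗ (aw≡ x)

    rᵗ : x ∈ Arg → y ∈ Arg → Translates v (r x y) (x ⟶ y)
    rᵗ x∈A y∈A = ∈-varᵗ (r≡ x∈A y∈A)

    module _ {p : Fin n → Prp n} (v≈E : Encodes p v E) where

      attackedᵗ : E ⊆ Arg → x ∈ Arg →
        Translates v (⋁ λ y → var (p y) ∧ᶠ r y x) ((F ⁺) E x)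
      attackedᵗ E⊆A x∈A = via (x∈A ,_) proj₂
        (⋁ᵗ λ y → ∈-varᵗ (v≈E y) ∧ᵗ λ y∈E → rᵗ (E⊆A y∈E) x∈A)

      -- Read with `in` for `p` this is `Rg`, with `in′` it is `Rg′`.
      rangeᵗ : E ⊆ Arg → ∀ x →
        Translates v (var (p x) ∨ᶠ (aw x ∧ᶠ ⋁ λ y → var (p y) ∧ᶠ r y x)) ((F ⊕) E x)
      rangeᵗ E⊆A x = ∈-varᵗ (v≈E x) ∨ᵗ
        via proj₂ (λ h → proj₁ h , h) (awᵗ x ∧ᵗ λ x∈A → attackedᵗ E⊆A x∈A)

    module _ (v≈E : Encodes `in v E) where

      inᵗ : ∀ x → Translates v (inᶠ x) (x ∈ E)
      inᵗ x = ∈-varᵗ (v≈E x)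

      wellᵗ : Translates v Well (E ⊆ Arg)
      wellᵗ = via (λ h → h _) (λ h _ → h) (⋀ᵗ λ x → inᵗ x →ᵗ λ _ → awᵗ x)

      defendsᵗ : E ⊆ Arg → a ∈ Arg →
        Translates v (⋀ λ y → (aw y ∧ᶠ r y a) →ᶠ (⋁ λ z → inᶠ z ∧ᶠ r z y)) (Defends F E a)
      defendsᵗ E⊆A a∈A = via (λ h x x∈A x⟶a → h x (x∈A , x⟶a)) (λ h x → uncurry (h x))
        (⋀ᵗ λ y → (awᵗ y ∧ᵗ λ y∈A → rᵗ y∈A a∈A) →ᵗ λ (y∈A , _) → attackedᵗ v≈E E⊆A y∈A)

  conFreeᵗ : Characterises ConFree (ConflictFree F)
  conFreeᵗ v∼F v≈E = wellᵗ v∼F v≈E ∧ᵗ λ E⊆A →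
    via (λ { h x x∈E (_ , y , y∈E , y⟶x) → h y x (y∈E , x∈E , y⟶x) })
        (λ { h x y (x∈E , y∈E , x⟶y) → h y y∈E (E⊆A y∈E , x , x∈E , x⟶y) })
    (⋀ᵗ λ x → ⋀ᵗ λ y → ¬ᵗ (inᵗ v∼F v≈E x ∧ᵗ λ x∈E → inᵗ v∼F v≈E y ∧ᵗ λ y∈E →
      rᵗ v∼F (E⊆A x∈E) (E⊆A y∈E)))

  admissibleᵗ : Characterises Admissible (AdmissibleSet F)
  admissibleᵗ v∼F v≈E = conFreeᵗ v∼F v≈E ∧ᵗ λ (E⊆A , _) →
    ⋀ᵗ λ x → inᵗ v∼F v≈E x →ᵗ λ x∈E → defendsᵗ v∼F v≈E E⊆A (E⊆A x∈E)

  completeᵗ : Characterises Complete (CompleteExt F)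
  completeᵗ v∼F v≈E = conFreeᵗ v∼F v≈E ∧ᵗ λ (E⊆A , _) →
    ⋀ᵗ λ x → awᵗ v∼F x →ᵗ λ x∈A → inᵗ v∼F v≈E x ↔ᵗ defendsᵗ v∼F v≈E E⊆A x∈A

  stableᵗ : Characterises Stable (StableExt F)
  stableᵗ {v} {E} v∼F v≈E = via to from (wellᵗ v∼F v≈E ∧ᵗ λ E⊆A →
    ⋀ᵗ λ x → awᵗ v∼F x →ᵗ λ x∈A → inᵗ v∼F v≈E x ↔ᵗ (¬ᵗ attackedᵗ v∼F v≈E E⊆A x∈A))
    where
    to : (E ⊆ Arg × ∀ x → x ∈ Arg → (x ∈ E ⇔ (¬ (F ⁺) E x))) → StableExt F E
    to (E⊆A , h) =
        (E⊆A , λ x x∈E → Equivalence.to (h x (E⊆A x∈E)) x∈E)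
      -- The formula only refutes that `x` is unattacked; `stable` turns this into an actual
      -- attacker.
      , λ x x∈A x∉E → stable (attackedᵗ v∼F v≈E E⊆A x∈A) (x∉E ∘ Equivalence.from (h x x∈A))

    from : StableExt F E → E ⊆ Arg × ∀ x → x ∈ Arg → (x ∈ E ⇔ (¬ (F ⁺) E x))
    from ((E⊆A , cf) , h) = E⊆A , λ x x∈A →
      mk⇔ (cf x) (λ ¬att → decidable-stable (x ∈? E) (¬att ∘ h x x∈A))

-- Maximal and minimal extensions

-- The second set is the changed one, and the Boolean is the value to which variables move.
Strictly : Bool → Subset n → Subset n → Set
Strictly true  E E′ = E ⊂ E′
Strictly false E E′ = E′ ⊂ E

-- Makes `IN` nonempty. Over an empty universe the union in `mkOne` would be `skip`, and its
-- outcomes would not be strict changes.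
anArgument : {{NonZero n}} → Fin n
anArgument {n = suc _} = zero

strictly⁺ : ∀ b → (∀ x → lookup E x ≡ b → lookup E′ x ≡ b) →
  lookup E x ≡ not b → lookup E′ x ≡ b → Strictly b E E′
strictly⁺ true h e e′ =
  (λ {y} y∈E → lookup⇒[]= y _ (h y ([]=⇒lookup y∈E))) , _ , lookup⇒[]= _ _ e′ , lookup⇒∉ e
strictly⁺ {E = E} false h e e′ =
  -- Here `h` says that absence from `E` persists; inclusion is its contrapositive.
  (λ {y} y∈E′ → decidable-stable (y ∈? E) λ y∉E → lookup⇒∉ (h y (∉⇒lookup y∉E)) y∈E′)
  , _ , lookup⇒[]= _ _ e , lookup⇒∉ e′

strictly⁻ : ∀ b → Strictly b E E′ →
  (∀ x → lookup E x ≡ b → lookup E′ x ≡ b) ×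
  ∃[ x ] (lookup E x ≡ not b × lookup E′ x ≡ b)
strictly⁻ true (E⊆E′ , x , x∈E′ , x∉E) =
  (λ x e → []=⇒lookup (E⊆E′ (lookup⇒[]= x _ e))) , x , ∉⇒lookup x∉E , []=⇒lookup x∈E′
strictly⁻ false (E′⊆E , x , x∈E , x∉E′) =
  (λ x e → ∉⇒lookup (lookup⇒∉ e ∘ E′⊆E)) , x , []=⇒lookup x∈E , ∉⇒lookup x∉E′

module _ {{_ : NonZero n}} (F : AF n) where

  grow-outcomes : ∀ b {v : Valuation n} {E : Subset n} → Encodes `in v E →
    Outcomes v (grow b IN) (Strictly b E) (Into v)
  grow-outcomes b {v} {E} v≈E = outcomes describe realise
    where
    describe : ∀ {w} → ⟦ grow b IN ⟧ v w → ∃[ E′ ] (Strictly b E E′ × Into v E′ w)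
    describe {w} s with grow⁻ b (`in∈IN anArgument) s
    ... | frame , mono , q , q∈IN , vq , wq with ∈-map⁻ `in q∈IN
    ...   | x , _ , refl = decode `in w
      , strictly⁺ b (λ y e → trans (sym (w≈ y)) (mono (`in y) (trans (v≈E y) e)))
                    (trans (sym (v≈E x)) vq) (trans (sym (w≈ x)) wq)
      , frame , w≈
      where w≈ = decode-encodes `in w

    realise : ∀ E′ → Strictly b E E′ → ∃[ w ] (⟦ grow b IN ⟧ v w × Into v E′ w)
    realise E′ h with strictly⁻ b h
    ... | mono , x , e , e′ = overwrite v E′
      , grow⁺ b (overwrite-unchanged v E′) mono′ (`in∈IN x) (trans (v≈E x) e) e′
      , overwrite-unchanged v E′ , (λ _ → refl)
      where
      mono′ : ∀ q → v q ≡ b → overwrite v E′ q ≡ b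
      mono′ (`in y)    e = mono y (trans (sym (v≈E y)) e)
      mono′ (`aw _)    e = e
      mono′ (`in′ _)   e = e
      mono′ (`r _ _)   e = e
      mono′ (`other _) e = e

  -- For `b = true` and `b = false` the box unfolds to the maximality and minimality clauses, so
  -- that one proof serves `Grounded`, `Preferred`, `Ideal` and `Eager`.
  extremalᵗ : ∀ b {X : Subset n → Set} → Characterises F φ X →
    Characterises F (φ ∧ᶠ [ grow b IN ] ¬ᶠ φ) (λ E → X E × ∀ E′ → X E′ → ¬ Strictly b E E′)
  extremalᵗ b char v∼F v≈E = char v∼F v≈E ∧ᵗ λ _ →
    via (λ h E′ XE′ lt → h E′ lt XE′) (λ h E′ lt XE′ → h E′ XE′ lt)
    (□ᵗ (grow-outcomes b v≈E) λ _ (frame , w≈) → ¬ᵗ char (∼-unchanged frame v∼F) w≈)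

-- Preferred extensions as maximal admissible sets

module _ (F : AF n) where

  open AF F

  conflictFree-⊆ : E ⊆ E′ → ConflictFree F E′ → ConflictFree F E
  conflictFree-⊆ E⊆E′ (E′⊆A , cf) = (λ x∈E → E′⊆A (E⊆E′ x∈E)) ,
    λ { x x∈E (x∈A , y , y∈E , y⟶x) → cf x (E⊆E′ x∈E) (x∈A , y , E⊆E′ y∈E , y⟶x) }

  complete⇒admissible : CompleteExt F E → AdmissibleSet F E
  complete⇒admissible ((E⊆A , cf) , h) =
    (E⊆A , cf) , λ a a∈E → Equivalence.to (h a (E⊆A a∈E)) a∈E

  -- Dung's Fundamental Lemma. All members of the new set are defended by `E`. If one of them
  -- attacked another, `E` would attack the attacker; the attacker being defended too, `E` would
  -- then attack one of its own members.
  admissible-∪-defended : AdmissibleSet F E → x ∈ Arg → Defends F E x →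
    AdmissibleSet F (E ∪ ⁅ x ⁆)
  admissible-∪-defended {E} {x} ((E⊆A , cf) , def) x∈A def-x = (⊆A , cf′) , def′
    where
    E∪x = E ∪ ⁅ x ⁆

    split : y ∈ E∪x → y ∈ E ⊎ y ≡ x
    split y∈ = map-⊎₂ (x∈⁅y⁆⇒x≡y x) (x∈p∪q⁻ E ⁅ x ⁆ y∈)

    ⊆A : E∪x ⊆ Arg
    ⊆A y∈ with split y∈
    ... | inj₁ y∈E  = E⊆A y∈E
    ... | inj₂ refl = x∈A

    defends : ∀ y → y ∈ E∪x → Defends F E y
    defends y y∈ with split y∈
    ... | inj₁ y∈E  = def y y∈E
    ... | inj₂ refl = def-x

    unattacked : ∀ y → y ∈ E∪x → ¬ (F ⁺) E y
    unattacked y y∈ (_ , z , z∈E , z⟶y) with defends y y∈ z (E⊆A z∈E) z⟶y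
    ... | attacked = cf z z∈E attacked

    cf′ : ∀ y → y ∈ E∪x → ¬ (F ⁺) E∪x y
    cf′ y y∈ (y∈A , z , z∈ , z⟶y) = unattacked z z∈ (defends y y∈ z (⊆A z∈) z⟶y)

    def′ : ∀ y → y ∈ E∪x → Defends F E∪x y
    def′ y y∈ z z∈A z⟶y with defends y y∈ z z∈A z⟶y
    ... | _ , t , t∈E , t⟶z = z∈A , t , p⊆p∪q ⁅ x ⁆ t∈E , t⟶z

  MaximalAdmissible : Subset n → Set
  MaximalAdmissible E = AdmissibleSet F E × ∀ E′ → AdmissibleSet F E′ → ¬ (E ⊂ E′)

  maximalAdmissible⇒complete : MaximalAdmissible E → CompleteExt F E
  maximalAdmissible⇒complete {E} (adm@(cf , def) , max) = cf , λ x x∈A →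
    mk⇔ (def x) λ def-x → decidable-stable (x ∈? E) λ x∉E →
      max (E ∪ ⁅ x ⁆) (admissible-∪-defended adm x∈A def-x)
        (p⊆p∪q ⁅ x ⁆ , x , x∈p∪q⁺ (inj₂ (x∈⁅x⁆ x)) , x∉E)

  -- Climb through ever larger admissible sets: one that cannot be enlarged is maximal and hence
  -- complete. Whether enlargement is possible is not decided, hence the double negation, which
  -- suffices for refuting larger sets.
  admissible⇒¬¬⊆complete : AdmissibleSet F E → ¬ (∀ E′ → CompleteExt F E′ → ¬ (E ⊆ E′))
  admissible⇒¬¬⊆complete = go (⊃-wellFounded _)
    where
    go : Acc (flip _⊂_) E → AdmissibleSet F E → ¬ (∀ E′ → CompleteExt F E′ → ¬ (E ⊆ E′))
    go {E} (acc rec) adm none = none E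
      (maximalAdmissible⇒complete (adm , λ E′ adm′ E⊂E′ →
        go (rec E⊂E′) adm′ λ E″ comp E′⊆E″ → none E″ comp λ x∈E → E′⊆E″ (proj₁ E⊂E′ x∈E)))
      (λ x∈E → x∈E)

  maximalAdmissible⇒preferred : MaximalAdmissible E → PreferredExt F E
  maximalAdmissible⇒preferred max = maximalAdmissible⇒complete max ,
    λ E′ comp → proj₂ max E′ (complete⇒admissible comp)

  -- A larger admissible set would lie inside a complete one, which would still contain the witness
  -- of strictness.
  preferred⇒maximalAdmissible : PreferredExt F E → MaximalAdmissible E
  preferred⇒maximalAdmissible (comp , max) = complete⇒admissible comp ,
    λ { E′ adm (E⊆E′ , x , x∈E′ , x∉E) → admissible⇒¬¬⊆complete adm λ E″ comp″ E′⊆E″ →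
      max E″ comp″ ((λ y∈E → E′⊆E″ (E⊆E′ y∈E)) , x , E′⊆E″ x∈E′ , x∉E) }

-- Adding one argument

lookup-∪-⁅⁆ : ∀ E y → w ≗ v [ `in x ≔ true ] → Encodes `in v E → w (`in y) ≡ lookup (E ∪ ⁅ x ⁆) y
lookup-∪-⁅⁆ {v = v} {x = x} E y e v≈E = trans (e (`in y)) (added (`in y ≟ `in x))
  where
  added : Dec (`in y ≡ `in x) → (v [ `in x ≔ true ]) (`in y) ≡ lookup (E ∪ ⁅ x ⁆) y
  added (yes refl) = trans (≔-same v (`in x)) (sym ([]=⇒lookup (x∈p∪q⁺ {p = E} (inj₂ (x∈⁅x⁆ x)))))
  added (no y≢x) = trans (≔-other v y≢x) (trans (v≈E y) (≡true-ext
    (λ h → []=⇒lookup (p⊆p∪q ⁅ x ⁆ (lookup⇒[]= y E h)))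
    (λ h → []=⇒lookup
      ([ (λ y∈E → y∈E) , (λ y∈x → contradiction (cong `in (x∈⁅y⁆⇒x≡y x y∈x)) y≢x) ]′
        (x∈p∪q⁻ E ⁅ x ⁆ (lookup⇒[]= y _ h))))))

-- Outcomes are indexed by the added argument rather than by the resulting set, which is the form in
-- which `Naive` is compared with maximality.
add-outcomes : {{_ : NonZero n}} {v : Valuation n} {E : Subset n} → Encodes `in v E →
  Outcomes v (mkTrueOne IN) (_∉ E) (λ x → Into v (E ∪ ⁅ x ⁆))
add-outcomes {v = v} {E = E} v≈E = outcomes describe realise
  where
  frame : w ≗ v [ `in x ≔ true ] → Unchanged v w
  frame e q q∉IN = unchanged e (∈∉⇒≢ (`in∈IN _) q∉IN)

  describe : ⟦ mkTrueOne IN ⟧ v w → ∃[ x ] (x ∉ E × Into v (E ∪ ⁅ x ⁆) w)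
  describe s with mkOne⁻ true (`in∈IN anArgument) s
  ... | q , q∈IN , vq , e with ∈-map⁻ `in q∈IN
  ...   | x , _ , refl = x , lookup⇒∉ (trans (sym (v≈E x)) vq) , frame e
    , λ y → lookup-∪-⁅⁆ {v = v} E y e v≈E

  realise : ∀ x → x ∉ E → ∃[ w ] (⟦ mkTrueOne IN ⟧ v w × Into v (E ∪ ⁅ x ⁆) w)
  realise x x∉E = v [ `in x ≔ true ]
    , mkOne⁺ true (`in∈IN x) (trans (v≈E x) (∉⇒lookup x∉E)) (λ _ → refl)
    , frame (λ _ → refl) , λ y → lookup-∪-⁅⁆ {v = v} E y (λ _ → refl) v≈E

-- Copies, comparison of ranges, and ideal and eager sets

copy : Fin n → Program n
copy x = (inᶠ x ¿ ⨾ + `in′ x) ⊔ ((¬ᶠ inᶠ x) ¿ ⨾ - `in′ x)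

copy⁻ : ⟦ copy x ⟧ v w → w ≗ v [ `in′ x ≔ v (`in x) ]
copy⁻ {x = x} {v = v} (inj₁ (u , (e , h) , t)) q =
  trans (t q) (trans (≔-cong (`in′ x) e q) (cong (λ c → (v [ `in′ x ≔ c ]) q) (sym (T⇒≡ h))))
copy⁻ {x = x} {v = v} (inj₂ (u , (e , h) , t)) q =
  trans (t q) (trans (≔-cong (`in′ x) e q)
    (cong (λ c → (v [ `in′ x ≔ c ]) q) (sym (literal⁻ {v = v} {p = `in x} false h))))

copy⁺ : ∀ c → v (`in x) ≡ c → ⟦ copy x ⟧ v (v [ `in′ x ≔ c ])
copy⁺ {v = v} {x = x} true  e = inj₁ (_ , ((λ _ → refl) , ≡⇒T e) , λ _ → refl)
copy⁺ {v = v} {x = x} false e =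
  inj₂ (_ , ((λ _ → refl) , literal⁺ {v = v} {p = `in x} false e) , λ _ → refl)

overwrite′ : Valuation n → Subset n → Valuation n
overwrite′ v E (`in′ x) = lookup E x
overwrite′ v E q        = v q

module _ (F : AF n) where

  open AF F

  -- Copying involves no choice, hence the trivial index. Nothing is recorded about the variables
  -- `in`, since the `vary IN` that follows overwrites them.
  copy-outcomes : {v : Valuation n} {E : Subset n} → v ∼ F → Encodes `in v E →
    Outcomes v copy-IN (λ (_ : ⊤) → ⊤) (λ _ w → w ∼ F × Encodes `in′ w E)
  copy-outcomes {v} {E} v∼F v≈E = outcomes describe realise
    where
    open _∼_ v∼F

    frame : (∀ x → q ≢ `in′ x) → ⟦ copy-IN ⟧ v w → w q ≡ v q
    frame q≢ s = preserve _ ≡-resp-≗ (allFin n)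
      (λ {x} _ t h → trans (unchanged (copy⁻ t) (q≢ x)) h) s refl

    -- Both variables are read in the same state: `establish` considers a step from an arbitrary
    -- state, where `in x` is not known to have its initial value.
    copied : ⟦ copy-IN ⟧ v w → ∀ x → w (`in′ x) ≡ w (`in x)
    copied s x = establish copy {P = λ x u → u (`in′ x) ≡ u (`in x)}
      (λ x e h → trans (sym (e _)) (trans h (e _))) (allFin n) est (λ {x} → keep {x}) s (∈-allFin x)
      where
      est : ∀ {x u w} → ⟦ copy x ⟧ u w → w (`in′ x) ≡ w (`in x)
      est {u = u} t = trans (copy⁻ t _) (trans (≔-same u _) (sym (unchanged (copy⁻ t) λ ())))

      keep : ∀ {x y u w} → ⟦ copy y ⟧ u w → u (`in′ x) ≡ u (`in x) → w (`in′ x) ≡ w (`in x)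
      keep {x} {y} t h with `in′ x ≟ `in′ y
      ... | yes refl = est t
      ... | no ≢     = trans (unchanged (copy⁻ t) ≢) (trans h (sym (unchanged (copy⁻ t) λ ())))

    describe : ⟦ copy-IN ⟧ v w → ∃[ t ] (⊤ × w ∼ F × Encodes `in′ w E)
    describe s = tt , tt
      , record { aw≡ = λ x → trans (frame (λ _ ()) s) (aw≡ x)
               ; r≡ = λ x∈A y∈A → trans (frame (λ _ ()) s) (r≡ x∈A y∈A) }
      , λ x → trans (copied s x) (trans (frame (λ _ ()) s) (v≈E x))

    step : ∀ {x} → x ∈ₗ allFin n → ∀ u → (∀ q → u q ≡ v q ⊎ u q ≡ overwrite′ v E q) →
      ⟦ copy x ⟧ u (u [ `in′ x ≔ lookup E x ])
    step {x} _ u between =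
      copy⁺ _ (trans ([ (λ e → e) , (λ e → e) ]′ (between (`in x))) (v≈E x))

    others : ∀ q → q ∉ₗ map `in′ (allFin n) → overwrite′ v E q ≡ v q
    others (`in′ x)   q∉ = contradiction (∈-map⁺ `in′ (∈-allFin x)) q∉
    others (`in _)    _  = refl
    others (`aw _)    _  = refl
    others (`r _ _)   _  = refl
    others (`other _) _  = refl

    realise : (t : ⊤) → ⊤ → ∃[ w ] (⟦ copy-IN ⟧ v w × w ∼ F × Encodes `in′ w E)
    realise _ _ = overwrite′ v E , steer copy `in′ (allFin n) step others
      , record { aw≡ = aw≡ ; r≡ = r≡ } , λ _ → refl

  -- Covers `SemiStable` and `Stage`. The formula says that a range including that of `E` is
  -- included in it; excluding strict inclusion yields this only up to a double negation, which
  -- `stable` removes.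
  rangeMaximalᵗ : {X : Subset n → Set} → (∀ E → X E → E ⊆ Arg) → Characterises F φ X →
    Characterises F (φ ∧ᶠ [ copy-IN ⨾ makeExt[ φ ] ] (IncludesCp →ᶠ IncludedInCp))
      (λ E → X E × ∀ E′ → X E′ → ¬ ((F ⊕) E ⊂ᴾ (F ⊕) E′))
  rangeMaximalᵗ {X = X} ⊆Arg char {v} {E} v∼F v≈E = char v∼F v≈E ∧ᵗ λ XE →
    via (λ h E′ XE′ (⊆ , ⊉) → ⊉ (h tt tt E′ XE′ (λ _ → ⊆) _))
        (λ h _ _ E′ XE′ ⊆ x x∈E′⊕ → stable (rangeᵗ F v∼F v≈E (⊆Arg _ XE) x) λ x∉E⊕ →
          h E′ XE′ ((λ {y} → ⊆ y) , λ ⊇ → x∉E⊕ (⊇ x∈E′⊕)))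
    (□-⨾ᵗ (□ᵗ (copy-outcomes {E = E} v∼F v≈E) λ _ (u∼F , u≈E) →
      □ᵗ (makeExt-outcomes F char u∼F) λ XE′ (frame , w≈E′) →
        let w∼F = ∼-unchanged frame u∼F
            w≈E = λ x → trans (frame _ (`in′∉IN x)) (u≈E x)
            -- After copying and varying, the primed variables hold the original set `E` and the
            -- unprimed ones its competitor.
            Rg′ᵗ = rangeᵗ F w∼F w≈E (⊆Arg _ XE)
            Rgᵗ  = rangeᵗ F w∼F w≈E′ (⊆Arg _ XE′)
        in (⋀ᵗ λ x → Rg′ᵗ x →ᵗ λ _ → Rgᵗ x) →ᵗ λ _ → ⋀ᵗ λ x → Rgᵗ x →ᵗ λ _ → Rg′ᵗ x))

  -- Covers `IdealSet` and `EagerSet`. The index `x` retains a member of `E` while `makeExt`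
  -- overwrites the variables `in`.
  containedᵗ : {X : Subset n → Set} → Characterises F φ X →
    Characterises F (Admissible ∧ᶠ (⋀ λ x → inᶠ x →ᶠ [ makeExt[ φ ] ] inᶠ x))
      (λ E → AdmissibleSet F E × ∀ E′ → X E′ → E ⊆ E′)
  containedᵗ char v∼F v≈E = admissibleᵗ F v∼F v≈E ∧ᵗ λ _ →
    via (λ h E′ XE′ x∈E → h _ x∈E E′ XE′) (λ h x x∈E E′ XE′ → h E′ XE′ x∈E)
    (⋀ᵗ λ x → inᵗ F v∼F v≈E x →ᵗ λ _ → □ᵗ (makeExt-outcomes F char v∼F)
      λ _ (frame , w≈) → inᵗ F (∼-unchanged frame v∼F) w≈ x)

-- Characteristic formulas of all semantics

module _ {{_ : NonZero n}} (F : AF n) where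

  preferredᵗ : Characterises F Preferred (PreferredExt F)
  preferredᵗ v∼F v≈E = via (maximalAdmissible⇒preferred F) (preferred⇒maximalAdmissible F)
    (extremalᵗ F true (admissibleᵗ F) v∼F v≈E)

  naiveᵗ : Characterises F Naive (NaiveExt F)
  naiveᵗ {v} {E} v∼F v≈E = conFreeᵗ F v∼F v≈E ∧ᵗ λ _ → via to from
    (□ᵗ (add-outcomes v≈E) λ _ (frame , w≈) → ¬ᵗ conFreeᵗ F (∼-unchanged frame v∼F) w≈)
    where
    to : (∀ x → x ∉ E → ¬ ConflictFree F (E ∪ ⁅ x ⁆)) →
         ∀ E′ → ConflictFree F E′ → ¬ (E ⊂ E′)
    to h E′ cf (E⊆E′ , x , x∈E′ , x∉E) = h x x∉E (conflictFree-⊆ F ∪⊆E′ cf)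
      where
      ∪⊆E′ : E ∪ ⁅ x ⁆ ⊆ E′
      ∪⊆E′ y∈ with x∈p∪q⁻ E ⁅ x ⁆ y∈
      ... | inj₁ y∈E = E⊆E′ y∈E
      ... | inj₂ y∈x with x∈⁅y⁆⇒x≡y x y∈x
      ...   | refl = x∈E′

    from : (∀ E′ → ConflictFree F E′ → ¬ (E ⊂ E′)) →
           ∀ x → x ∉ E → ¬ ConflictFree F (E ∪ ⁅ x ⁆)
    from h x x∉E cf = h (E ∪ ⁅ x ⁆) cf (p⊆p∪q ⁅ x ⁆ , x , x∈p∪q⁺ (inj₂ (x∈⁅x⁆ x)) , x∉E)

  semiStableᵗ : Characterises F SemiStable (SemiStableExt F)
  semiStableᵗ = rangeMaximalᵗ F (λ _ ((⊆A , _) , _) → ⊆A) (completeᵗ F)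

  characteristicᵗ : ∀ σ → Characterises F (characteristic σ) (Extension σ F)
  characteristicᵗ st  = stableᵗ F
  characteristicᵗ co  = completeᵗ F
  characteristicᵗ gr  = extremalᵗ F false (completeᵗ F)
  characteristicᵗ pr  = preferredᵗ
  characteristicᵗ se  = semiStableᵗ
  characteristicᵗ id  = extremalᵗ F true (containedᵗ F preferredᵗ)
  characteristicᵗ ea  = extremalᵗ F true (containedᵗ F semiStableᵗ)
  characteristicᵗ na  = naiveᵗ
  characteristicᵗ stg = rangeMaximalᵗ F (λ _ (⊆A , _) → ⊆A) (conFreeᵗ F)

-- Membership in the lists of variables

does⁻ : (d : Dec P) → does d ≡ true → P
does⁻ (yes h) _ = h

valuation⁺ : {K : List (Prp n)} → q ∈ₗ K → valuation K q ≡ true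
valuation⁺ q∈K = dec-true (member? _≟_ _ _) q∈K

valuation⁻ : (K : List (Prp n)) → valuation K q ≡ true → q ∈ₗ K
valuation⁻ K = does⁻ (member? _≟_ _ K)

∈-AW⁺ : {A : Subset n} → x ∈ A → `aw x ∈ₗ AW A
∈-AW⁺ {x = x} {A = A} x∈A = ∈-map∘filter⁺ `aw (_∈? A) (x , ∈-allFin x , refl , x∈A)

∈-AW⁻ : (A : Subset n) → q ∈ₗ AW A → ∃[ x ] (q ≡ `aw x × x ∈ A)
∈-AW⁻ A q∈ with ∈-map∘filter⁻ `aw (_∈? A) {xs = allFin _} q∈
... | x , _ , q≡ , x∈A = x , q≡ , x∈A

∈-pairs⁺ : {R : Relation n} → ⌊ R ⌋ x y → (x , y) ∈ₗ pairs R
∈-pairs⁺ {x = x} {y = y} {R = R} = ∈-filter⁺ (λ xy → proj₂ xy ∈? R (proj₁ xy))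
  (∈-cartesianProduct⁺ (∈-allFin x) (∈-allFin y))

∈-pairs⁻ : (R : Relation n) → (x , y) ∈ₗ pairs R → ⌊ R ⌋ x y
∈-pairs⁻ {n = n} R xy∈ = proj₂ (∈-filter⁻ (λ xy → proj₂ xy ∈? R (proj₁ xy))
  {xs = cartesianProduct (allFin n) (allFin n)} xy∈)

∈-ATT⁺ : {R : Relation n} → ⌊ R ⌋ x y → `r x y ∈ₗ ATT R
∈-ATT⁺ {R = R} xRy = ∈-map⁺ (λ (x , y) → `r x y) (∈-pairs⁺ {R = R} xRy)

∈-ATT⁻ : (R : Relation n) → q ∈ₗ ATT R → ∃[ x ] ∃[ y ] (q ≡ `r x y × ⌊ R ⌋ x y)
∈-ATT⁻ R q∈ with ∈-map⁻ (λ (x , y) → `r x y) q∈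
... | (x , y) , xy∈ , q≡ = x , y , q≡ , ∈-pairs⁻ R xy∈

`aw∈AW⁻ : (A : Subset n) → `aw x ∈ₗ AW A → x ∈ A
`aw∈AW⁻ A q∈ with ∈-AW⁻ A q∈
... | _ , refl , x∈A = x∈A

`aw∉ATT : (R : Relation n) → `aw x ∉ₗ ATT R
`aw∉ATT R q∈ with ∈-ATT⁻ R q∈
... | _ , _ , () , _

`r∉AW : (A : Subset n) → `r x y ∉ₗ AW A
`r∉AW A q∈ with ∈-AW⁻ A q∈
... | _ , () , _

`r∈ATT⁻ : (R : Relation n) → `r x y ∈ₗ ATT R → ⌊ R ⌋ x y
`r∈ATT⁻ R q∈ with ∈-ATT⁻ R q∈
... | _ , _ , refl , xRy = xRy

-- Outcomes of `dis`

resolve : Fin n × Fin n → Program n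
resolve (x , y) = + `r x y ⊔ + `r y x

dis-monotone : (R : Relation n) → ⟦ dis R ⟧ v w → v q ≡ true → w q ≡ true
dis-monotone {q = q} R s h = preserve resolve ≡-resp-≗ (pairs R) (λ _ → step) s h
  where
  step : ∀ {xy u u′} → ⟦ resolve xy ⟧ u u′ → u q ≡ true → u′ q ≡ true
  step (inj₁ e) h = assign-monotone q e h
  step (inj₂ e) h = assign-monotone q e h

-- The step for a pair may set the variable of the reversed pair, which belongs to `ATT R` by
-- symmetry.
dis-frame : (R : Relation n) → Symmetric ⌊ R ⌋ → ⟦ dis R ⟧ v w → q ∉ₗ ATT R → w q ≡ v q
dis-frame {q = q} R R-sym s q∉ = preserve resolve ≡-resp-≗ (pairs R) step s refl
  where
  step : ∀ {xy u u′ c} → xy ∈ₗ pairs R → ⟦ resolve xy ⟧ u u′ → u q ≡ c → u′ q ≡ c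
  step xy∈ (inj₁ e) h =
    trans (unchanged e (∈∉⇒≢ (∈-ATT⁺ {R = R} (∈-pairs⁻ R xy∈)) q∉)) h
  step xy∈ (inj₂ e) h =
    trans (unchanged e (∈∉⇒≢ (∈-ATT⁺ {R = R} (R-sym (∈-pairs⁻ R xy∈))) q∉)) h

dis-resolves : (R : Relation n) → ⟦ dis R ⟧ v w → ⌊ R ⌋ x y →
  w (`r x y) ≡ true ⊎ w (`r y x) ≡ true
dis-resolves {n = n} R s xRy = establish resolve {P = Resolved} resp (pairs R)
  est (λ {xy} {zt} → keep {xy} {zt}) s (∈-pairs⁺ {R = R} xRy)
  where
  Resolved : Fin n × Fin n → Valuation n → Set
  Resolved (x , y) u = u (`r x y) ≡ true ⊎ u (`r y x) ≡ true

  resp : ∀ xy → Respects≗ (Resolved xy)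
  resp xy e = map-⊎ (≡-resp-≗ e) (≡-resp-≗ e)

  est : ∀ {xy u u′} → ⟦ resolve xy ⟧ u u′ → Resolved xy u′
  est {x , y} {u} (inj₁ e) = inj₁ (trans (e _) (≔-same u (`r x y)))
  est {x , y} {u} (inj₂ e) = inj₂ (trans (e _) (≔-same u (`r y x)))

  keep : ∀ {xy zt u u′} → ⟦ resolve zt ⟧ u u′ → Resolved xy u → Resolved xy u′
  keep (inj₁ e) = map-⊎ (assign-monotone _ e) (assign-monotone _ e)
  keep (inj₂ e) = map-⊎ (assign-monotone _ e) (assign-monotone _ e)

≡true-frame : {L : List (Prp n)} → (∀ q → v q ≡ true → w q ≡ true) →
  (∀ q → w q ≡ true → v q ≡ true ⊎ q ∈ₗ L) → ∀ q → q ∉ₗ L → w q ≡ v q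
≡true-frame mono new q q∉ = ≡true-ext
  (λ h → [ (λ e → e) , (λ q∈ → contradiction q∈ q∉) ]′ (new q h)) (mono q)

-- Step `(x , y)` sets `r x y` if `w` makes it true and `r y x` otherwise, which `w` then makes true
-- by `resolved`. Thus nothing false in `w` is set, and each new variable is the target of its own
-- pair.
dis-reaches : (R : Relation n) → (∀ q → v q ≡ true → w q ≡ true) →
  (∀ q → w q ≡ true → v q ≡ true ⊎ q ∈ₗ ATT R) →
  (∀ x y → ⌊ R ⌋ x y → w (`r x y) ≡ true ⊎ w (`r y x) ≡ true) →
  ⟦ dis R ⟧ v w
dis-reaches {n = n} {v = v} {w = w} R mono new resolved =
  steer resolve target (pairs R) step (≡true-frame mono targeted)
  where
  target : Fin n × Fin n → Prp n
  target (x , y) = if w (`r x y) then `r x y else `r y x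

  step : ∀ {xy} → xy ∈ₗ pairs R → ∀ u → (∀ q → u q ≡ v q ⊎ u q ≡ w q) →
    ⟦ resolve xy ⟧ u (u [ target xy ≔ w (target xy) ])
  step {x , y} xy∈ u _ with w (`r x y) in eq | resolved x y (∈-pairs⁻ R xy∈)
  ... | true  | _      = inj₁ λ q → cong (λ c → (u [ `r x y ≔ c ]) q) eq
  ... | false | inj₂ e = inj₂ λ q → cong (λ c → (u [ `r y x ≔ c ]) q) e

  targeted : ∀ q → w q ≡ true → v q ≡ true ⊎ q ∈ₗ map target (pairs R)
  targeted q wq with new q wq
  ... | inj₁ vq = inj₁ vq
  ... | inj₂ q∈ with ∈-ATT⁻ R q∈
  ...   | x , y , refl , xRy = inj₂ (subst (_∈ₗ map target (pairs R))
    (cong (if_then `r x y else `r y x) wq) (∈-map⁺ target (∈-pairs⁺ {R = R} xRy)))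

-- The framework of a valuation

∈-tabulate⁺ : {f : Fin n → Bool} → f x ≡ true → x ∈ tabulate f
∈-tabulate⁺ {x = x} {f = f} h = lookup⇒[]= x _ (trans (lookup∘tabulate f x) h)

∈-tabulate⁻ : {f : Fin n → Bool} → x ∈ tabulate f → f x ≡ true
∈-tabulate⁻ {x = x} {f = f} h = trans (sym (lookup∘tabulate f x)) ([]=⇒lookup h)

framework : Valuation n → AF n
framework v = record
  { Arg   = tabulate (v ∘ `aw)
  ; Att   = λ x → tabulate λ y → v (`r x y) ∧ v (`aw x) ∧ v (`aw y)
  ; Att⊆² = λ x y h → let ends = ∧-conicalʳ (v (`r x y)) _ (∈-tabulate⁻ h) in
      ∈-tabulate⁺ (∧-conicalˡ (v (`aw x)) (v (`aw y)) ends)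
    , ∈-tabulate⁺ (∧-conicalʳ (v (`aw x)) (v (`aw y)) ends)
  }

∼-framework : (v : Valuation n) → v ∼ framework v
∼-framework v = record
  { aw≡ = λ x → sym (lookup∘tabulate _ x)
  ; r≡  = λ {x} {y} x∈A y∈A → sym (trans (lookup∘tabulate _ y)
      (trans (cong₂ (λ a b → v (`r x y) ∧ a ∧ b) (∈-tabulate⁻ x∈A) (∈-tabulate⁻ y∈A))
             (∧-identityʳ _)))
  }

toRelation : {R : Rel (Fin n) 0ℓ} → Decidable R → Relation n
toRelation R? x = tabulate λ y → does (R? x y)

-- Outcomes of `makeComp` and completions

module _ (I : RIAF n) where

  open RIAF I

  module Describe {u : Valuation n} (comp : ⟦ makeComp I ⟧ (initial I) u) where

    monotone : ∀ q → initial I q ≡ true → u q ≡ true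
    monotone q h = let (_ , s , _ , t , d) = comp in dis-monotone R↔ d
      (mkSome-monotone true (ATT R?) t (mkSome-monotone true (AW A?) s h))

    -- A variable in none of the three lists keeps its initial value throughout `makeComp`.
    provenance : ∀ q → u q ≡ true →
      q ∈ₗ AW Aᶠ ++ ATT Rᶠ ⊎ q ∈ₗ AW A? ⊎ q ∈ₗ ATT R? ⊎ q ∈ₗ ATT R↔
    provenance q h with member? _≟_ q (AW A?) | member? _≟_ q (ATT R?) | member? _≟_ q (ATT R↔)
    ... | yes q∈  | _       | _       = inj₂ (inj₁ q∈)
    ... | no _    | yes q∈  | _       = inj₂ (inj₂ (inj₁ q∈))
    ... | no _    | no _    | yes q∈  = inj₂ (inj₂ (inj₂ q∈))
    ... | no q∉A? | no q∉R? | no q∉R↔ = let (_ , s , _ , t , d) = comp in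
      inj₁ (valuation⁻ (AW Aᶠ ++ ATT Rᶠ) (trans (sym (trans (dis-frame R↔ R↔-symmetric d q∉R↔)
        (trans (mkSome-frame true (ATT R?) t q∉R?) (mkSome-frame true (AW A?) s q∉A?)))) h))

    aw-provenance : u (`aw x) ≡ true → x ∈ Aᶠ ⊎ x ∈ A?
    aw-provenance h with provenance _ h
    ... | inj₂ (inj₁ q∈)        = inj₂ (`aw∈AW⁻ A? q∈)
    ... | inj₂ (inj₂ (inj₁ q∈)) = contradiction q∈ (`aw∉ATT R?)
    ... | inj₂ (inj₂ (inj₂ q∈)) = contradiction q∈ (`aw∉ATT R↔)
    ... | inj₁ q∈ with ∈-++⁻ (AW Aᶠ) q∈
    ...   | inj₁ q∈Aᶠ = inj₁ (`aw∈AW⁻ Aᶠ q∈Aᶠ)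
    ...   | inj₂ q∈Rᶠ = contradiction q∈Rᶠ (`aw∉ATT Rᶠ)

    r-provenance : u (`r x y) ≡ true → ⌊ Rᶠ ⌋ x y ⊎ ⌊ R? ⌋ x y ⊎ ⌊ R↔ ⌋ x y
    r-provenance h with provenance _ h
    ... | inj₂ (inj₁ q∈)        = contradiction q∈ (`r∉AW A?)
    ... | inj₂ (inj₂ (inj₁ q∈)) = inj₂ (inj₁ (`r∈ATT⁻ R? q∈))
    ... | inj₂ (inj₂ (inj₂ q∈)) = inj₂ (inj₂ (`r∈ATT⁻ R↔ q∈))
    ... | inj₁ q∈ with ∈-++⁻ (AW Aᶠ) q∈
    ...   | inj₁ q∈Aᶠ = contradiction q∈Aᶠ (`r∉AW Aᶠ)
    ...   | inj₂ q∈Rᶠ = inj₁ (`r∈ATT⁻ Rᶠ q∈Rᶠ)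

    open AF (framework u)

    attack⁺ : x ∈ Arg → y ∈ Arg → u (`r x y) ≡ true → x ⟶ y
    attack⁺ x∈A y∈A h = lookup⇒[]= _ _ (trans (sym (_∼_.r≡ (∼-framework u) x∈A y∈A)) h)

    attack⁻ : x ⟶ y → x ∈ Arg × y ∈ Arg × u (`r x y) ≡ true
    attack⁻ x⟶y with Att⊆² _ _ x⟶y
    ... | x∈A , y∈A = x∈A , y∈A , trans (_∼_.r≡ (∼-framework u) x∈A y∈A) ([]=⇒lookup x⟶y)

    isCompletion : IsCompletion I (framework u)
    isCompletion = record
      { Aᶠ⊆Arg      = λ x∈ → ∈-tabulate⁺ (monotone _ (valuation⁺ (∈-++⁺ˡ (∈-AW⁺ x∈))))
      ; Arg⊆Aᶠ∪A?   = λ x∈ → x∈p∪q⁺ (aw-provenance (∈-tabulate⁻ x∈))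
      ; Rᶠ⊆Att      = λ (xRy , x∈A , y∈A) → attack⁺ x∈A y∈A
          (monotone _ (valuation⁺ (∈-++⁺ʳ (AW Aᶠ) (∈-ATT⁺ {R = Rᶠ} xRy))))
      ; Att⊆R       = λ x⟶y → let (x∈A , y∈A , h) = attack⁻ x⟶y in r-provenance h , x∈A , y∈A
      ; R↔-resolved = λ x y x∈A y∈A xRy → map-⊎ (attack⁺ x∈A y∈A) (attack⁺ y∈A x∈A)
          (dis-resolves R↔ (proj₂ (proj₂ (proj₂ (proj₂ comp)))) xRy)
      }

  module Realise (F : AF n) (c : IsCompletion I F) where

    open AF F
    open IsCompletion c

    -- The initial valuation and every stop on the way to `result` have this form, so that `state⁺`
    -- and `state⁻` reduce each leg to inclusions between argument sets and between relations.
    state : Subset n → Relation n → Valuation n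
    state A R = valuation (AW A ++ ATT R)

    state⁺ : ∀ {A A′} {R R′ : Relation n} → A ⊆ A′ → (∀ {x y} → ⌊ R ⌋ x y → ⌊ R′ ⌋ x y) →
      ∀ q → state A R q ≡ true → state A′ R′ q ≡ true
    state⁺ {A} {A′} {R} {R′} A⊆ R⊆ q h with ∈-++⁻ (AW A) (valuation⁻ (AW A ++ ATT R) h)
    ... | inj₁ q∈ with ∈-AW⁻ A q∈
    ...   | x , refl , x∈A = valuation⁺ (∈-++⁺ˡ (∈-AW⁺ (A⊆ x∈A)))
    state⁺ {A} {A′} {R} {R′} A⊆ R⊆ q h | inj₂ q∈ with ∈-ATT⁻ R q∈
    ... | x , y , refl , xRy = valuation⁺ (∈-++⁺ʳ (AW A′) (∈-ATT⁺ {R = R′} (R⊆ xRy)))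

    state⁻ : ∀ {L A A′} {R R′ : Relation n} → (∀ {x} → x ∈ A′ → x ∈ A ⊎ `aw x ∈ₗ L) →
      (∀ {x y} → ⌊ R′ ⌋ x y → ⌊ R ⌋ x y ⊎ `r x y ∈ₗ L) →
      ∀ q → state A′ R′ q ≡ true → state A R q ≡ true ⊎ q ∈ₗ L
    state⁻ {L} {A} {A′} {R} {R′} A⊇ R⊇ q h with ∈-++⁻ (AW A′) (valuation⁻ (AW A′ ++ ATT R′) h)
    ... | inj₁ q∈ with ∈-AW⁻ A′ q∈
    ...   | x , refl , x∈A = map-⊎₁ (λ x∈ → valuation⁺ (∈-++⁺ˡ (∈-AW⁺ x∈))) (A⊇ x∈A)
    state⁻ {L} {A} {A′} {R} {R′} A⊇ R⊇ q h | inj₂ q∈ with ∈-ATT⁻ R′ q∈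
    ... | x , y , refl , xRy =
      map-⊎₁ (λ xRy → valuation⁺ (∈-++⁺ʳ (AW A) (∈-ATT⁺ {R = R} xRy))) (R⊇ xRy)

    -- An R↔-edge with an unavailable end is not resolved in F, but dis resolves
    -- it all the same; here both directions are chosen.
    Certain Final : Rel (Fin n) 0ℓ
    Certain x y = ⌊ Rᶠ ⌋ x y ⊎ ⌊ R? ⌋ x y × x ⟶ y
    Final x y = Certain x y ⊎ ⌊ R↔ ⌋ x y × (x ⟶ y ⊎ ¬ (x ∈ Arg × y ∈ Arg))

    certain? : Decidable Certain
    certain? x y = (y ∈? Rᶠ x) ⊎-dec ((y ∈? R? x) ×-dec (y ∈? Att x))

    final? : Decidable Final
    final? x y = certain? x y ⊎-dec ((y ∈? R↔ x) ×-dec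
      ((y ∈? Att x) ⊎-dec ¬? ((x ∈? Arg) ×-dec (y ∈? Arg))))

    toRelation⁺ : {R : Rel (Fin n) 0ℓ} (d : Decidable R) → R x y → ⌊ toRelation d ⌋ x y
    toRelation⁺ d xRy = ∈-tabulate⁺ (dec-true (d _ _) xRy)

    toRelation⁻ : {R : Rel (Fin n) 0ℓ} (d : Decidable R) → ⌊ toRelation d ⌋ x y → R x y
    toRelation⁻ d h = does⁻ (d _ _) (∈-tabulate⁻ h)

    R₁ R₂ : Relation n
    R₁ = toRelation certain?
    R₂ = toRelation final?

    result : Valuation n
    result = state Arg R₂

    addArguments : ⟦ mkTrueSome (AW A?) ⟧ (initial I) (state Arg Rᶠ)
    addArguments = mkSome-reaches true (AW A?)
      (≡true-frame mono (state⁻ {A = Aᶠ} {R = Rᶠ}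
        (λ x∈ → map-⊎₂ ∈-AW⁺ (x∈p∪q⁻ Aᶠ A? (Arg⊆Aᶠ∪A? x∈))) inj₁))
      mono
      where mono = state⁺ {A = Aᶠ} {R = Rᶠ} {R′ = Rᶠ} Aᶠ⊆Arg λ h → h

    addAttacks : ⟦ mkTrueSome (ATT R?) ⟧ (state Arg Rᶠ) (state Arg R₁)
    addAttacks = mkSome-reaches true (ATT R?)
      (≡true-frame mono (state⁻ {A = Arg} {R = Rᶠ} inj₁ λ h →
        map-⊎₂ (λ (xRy , _) → ∈-ATT⁺ {R = R?} xRy) (toRelation⁻ certain? h)))
      mono
      where
      mono = state⁺ {A = Arg} {R = Rᶠ} {R′ = R₁} (λ h → h)
        (λ h → toRelation⁺ certain? (inj₁ h))

    disambiguate : ⟦ dis R↔ ⟧ (state Arg R₁) result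
    disambiguate = dis-reaches R↔
      (state⁺ {A = Arg} {R = R₁} {R′ = R₂} (λ h → h)
        (λ h → toRelation⁺ final? (inj₁ (toRelation⁻ certain? h))))
      (state⁻ {A = Arg} {R = R₁} inj₁ λ h → map-⊎ (toRelation⁺ certain?)
        (λ (xRy , _) → ∈-ATT⁺ {R = R↔} xRy) (toRelation⁻ final? h))
      (λ x y xRy → map-⊎ true⁺ true⁺ (resolved xRy))
      where
      true⁺ : Final x y → result (`r x y) ≡ true
      true⁺ h = valuation⁺ (∈-++⁺ʳ (AW Arg) (∈-ATT⁺ {R = R₂} (toRelation⁺ final? h)))

      resolved : ⌊ R↔ ⌋ x y → Final x y ⊎ Final y x
      resolved {x} {y} xRy with (x ∈? Arg) ×-dec (y ∈? Arg)
      ... | no ¬available = inj₁ (inj₂ (xRy , inj₂ ¬available))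
      ... | yes (x∈A , y∈A) with R↔-resolved x y x∈A y∈A xRy
      ...   | inj₁ x⟶y = inj₁ (inj₂ (xRy , inj₁ x⟶y))
      ...   | inj₂ y⟶x = inj₂ (inj₂ (R↔-symmetric xRy , inj₁ y⟶x))

    final⁻ : x ∈ Arg → y ∈ Arg → Final x y → x ⟶ y
    final⁻ x∈A y∈A (inj₁ (inj₁ xRy))            = Rᶠ⊆Att (xRy , x∈A , y∈A)
    final⁻ x∈A y∈A (inj₁ (inj₂ (_ , x⟶y)))      = x⟶y
    final⁻ x∈A y∈A (inj₂ (_ , inj₁ x⟶y))        = x⟶y
    final⁻ x∈A y∈A (inj₂ (_ , inj₂ ¬available)) = contradiction (x∈A , y∈A) ¬available

    final⁺ : x ⟶ y → Final x y
    final⁺ x⟶y with proj₁ (Att⊆R x⟶y)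
    ... | inj₁ xRy        = inj₁ (inj₁ xRy)
    ... | inj₂ (inj₁ xRy) = inj₁ (inj₂ (xRy , x⟶y))
    ... | inj₂ (inj₂ xRy) = inj₂ (xRy , inj₁ x⟶y)

    result∼F : result ∼ F
    result∼F = record
      { aw≡ = λ x → ≡true-ext
          (λ h → []=⇒lookup (aw⁻ (∈-++⁻ (AW Arg) (valuation⁻ (AW Arg ++ ATT R₂) h))))
          (λ h → valuation⁺ (∈-++⁺ˡ (∈-AW⁺ (lookup⇒[]= x Arg h))))
      ; r≡  = λ {x} {y} x∈A y∈A → ≡true-ext
          (λ h → []=⇒lookup (final⁻ x∈A y∈A
            (r⁻ (∈-++⁻ (AW Arg) (valuation⁻ (AW Arg ++ ATT R₂) h)))))
          (λ h → valuation⁺ (∈-++⁺ʳ (AW Arg) (∈-ATT⁺ {R = R₂}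
            (toRelation⁺ final? (final⁺ (lookup⇒[]= y (Att x) h))))))
      }
      where
      aw⁻ : `aw x ∈ₗ AW Arg ⊎ `aw x ∈ₗ ATT R₂ → x ∈ Arg
      aw⁻ (inj₁ q∈) = `aw∈AW⁻ Arg q∈
      aw⁻ (inj₂ q∈) = contradiction q∈ (`aw∉ATT R₂)

      r⁻ : `r x y ∈ₗ AW Arg ⊎ `r x y ∈ₗ ATT R₂ → Final x y
      r⁻ (inj₁ q∈) = contradiction q∈ (`r∉AW Arg)
      r⁻ (inj₂ q∈) = toRelation⁻ final? (`r∈ATT⁻ R₂ q∈)

  makeComp-outcomes : Outcomes (initial I) (makeComp I) (IsCompletion I) (λ F u → u ∼ F)
  makeComp-outcomes = outcomes
    (λ {u} comp → framework u , Describe.isCompletion comp , ∼-framework u)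
    (λ F c → let open Realise F c in
      result , (_ , addArguments , _ , addAttacks , disambiguate) , result∼F)

-- The four acceptance problems

proposition5 : (n : ℕ) {{_ : NonZero n}} (σ : Semantics) (I : RIAF n) (a : Fin n) →
    a ∈ RIAF.Aᶠ I →
    (NSA σ I a ⇔ (initial I ⊨ [ makeComp I ⨾ makeExt σ ] inᶠ a)) ×
    (NCA σ I a ⇔ (initial I ⊨ [ makeComp I ] ⟨ makeExt σ ⟩ inᶠ a)) ×
    (PCA σ I a ⇔ (initial I ⊨ ⟨ makeComp I ⨾ makeExt σ ⟩ inᶠ a)) ×
    (PSA σ I a ⇔ (initial I ⊨ ⟨ makeComp I ⟩ [ makeExt σ ] inᶠ a))
proposition5 n σ I a _ =
    ⇔⊨ (□-⨾ᵗ (□ᵗ (makeComp-outcomes I) λ _ u∼F → sceptical u∼F))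
  , ⇔⊨ (□ᵗ (makeComp-outcomes I) λ _ u∼F → credulous u∼F)
  , ⇔⊨ (◇-⨾ᵗ (◇ᵗ (makeComp-outcomes I) λ _ u∼F → credulous u∼F))
  , ⇔⊨ (◇ᵗ (makeComp-outcomes I) λ _ u∼F → sceptical u∼F)
  where
  ⇔⊨ : Translates v φ P → P ⇔ (v ⊨ φ)
  ⇔⊨ t = mk⇔ (to⊨ t) (from⊨ t)

  sceptical : {F : AF n} → u ∼ F →
    Translates u ([ makeExt σ ] inᶠ a) (∀ E → Extension σ F E → a ∈ E)
  sceptical {F = F} u∼F =
    □ᵗ (makeExt-outcomes F (characteristicᵗ F σ) u∼F) λ _ (_ , w≈E) → ∈-varᵗ (w≈E a)

  credulous : {F : AF n} → u ∼ F →
    Translates u (⟨ makeExt σ ⟩ inᶠ a) (∃[ E ] (Extension σ F E × a ∈ E))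
  credulous {F = F} u∼F =
    ◇ᵗ (makeExt-outcomes F (characteristicᵗ F σ) u∼F) λ _ (_ , w≈E) → ∈-varᵗ (w≈E a)
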